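{- Let $\mathcal O$ be a Krom-LTL ontology and let $A$ be an atomic concept. Then the ontology-mediated atomic query $\boldsymbol q=(\mathcal O,A)$ is $\mathrm{FO}(<,\equiv)$-rewritable. That is, there is a constant-free $\mathrm{FO}(<,\equiv)$-formula $\boldsymbol Q(t)$ with a single free variable $t$ such that, for every data instance $\mathcal A$, $\mathrm{ans}(\boldsymbol q,\mathcal A)=\{\ell\in\mathrm{tem}(\mathcal A)\mid \mathfrak S_{\mathcal A}\models\boldsymbol Q(\ell)\}$.
   Context: Fix a countably infinite set of atomic concepts $A_i$, $i<\omega$. A (temporal) interpretation $\mathfrak M$ assigns to every atomic concept $A$ a set $A^{\mathfrak M}\subseteq\mathbb Z$. The unary temporal operators are interpreted (strictly) by $(\bigcirc_F\varkappa)^{\mathfrak M}=\{n\mid n+1\in\varkappa^{\mathfrak M}\}$, $(\bigcirc_P\varkappa)^{\mathfrak M}=\{n\mid n-1\in\varkappa^{\mathfrak M}\}$, $(\Box_F\varkappa)^{\mathfrak M}=\{n\mid k\in\varkappa^{\mathfrak M}\text{ for all }k>n\}$, $(\Diamond_F\varkappa)^{\mathfrak M}=\{n\mid k\in\varkappa^{\mathfrak M}\text{ for some }k>n\}$, and symmetrically for $\Box_P,\Diamond_P$ with $k<n$; Boolean connectives are interpreted set-theoretically (negation is complement in $\mathbb Z$). Krom-LTL is the set of all formulas constructed using arbitrary Boolean operators from at most two formulas, each of which is an atomic concept prefixed with an arbitrary (possibly empty) sequence of unary operators from $\Box_P,\bigcirc_P,\Diamond_P,\Box_F,\bigcirc_F,\Diamond_F$.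 A Krom-LTL ontology $\mathcal O$ is a finite set of Krom-LTL formulas (axioms), interpreted globally: $\mathfrak M$ is a model of $\mathcal O$ if $\alpha^{\mathfrak M}=\mathbb Z$ for all $\alpha\in\mathcal O$. A data instance $\mathcal A$ is a finite set of ground atoms $A_i(\ell)$ with $\ell\in\mathbb Z$; $\min\mathcal A$ and $\max\mathcal A$ are the least and greatest integers occurring in it, and it is assumed throughout that $\min\mathcal A=0$ and $\max\mathcal A\ge 1$. Its active domain is $\mathrm{tem}(\mathcal A)=\{n\in\mathbb Z\mid\min\mathcal A\le n\le\max\mathcal A\}$. $\mathfrak M$ is a model of $(\mathcal O,\mathcal A)$ if it is a model of $\mathcal O$ and $\ell\in B^{\mathfrak M}$ for all $B(\ell)\in\mathcal A$. The set of certain answers is $\mathrm{ans}(\boldsymbol q,\mathcal A)=\{\ell\in\mathrm{tem}(\mathcal A)\mid \ell\in A^{\mathfrak M}\text{ for every model }\mathfrak M\text{ of }(\mathcal O,\mathcal A)\}$. $\mathfrak S_{\mathcal A}$ is the finite first-order structure with domain $\mathrm{tem}(\mathcal A)$ ordered by $<$, in which $\mathfrak S_{\mathcal A}\models B(\ell)$ iff $B(\ell)\in\mathcal A$, for every atomic concept $B$ (viewed as a unary predicate). $\mathrm{FO}(<,\equiv)$ is first-order logic over the unary predicates $A_i$, the binary predicate $<$, and the unary numeric predicates $t\equiv 0\pmod n$, for each fixed $n>1$, where $\mathfrak S_{\mathcal A}\models \ell\equiv 0\pmod n$ iff $n$ divides $\ell$. -}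

module Defs where

open import Data.Empty using (⊥)
open import Data.Fin.Base using (Fin)
open import Data.Integer.Base using (ℤ; +_; 0ℤ; 1ℤ; _+_; _-_; _≤_; _<_)
open import Data.Integer.Divisibility using (_∣_)
open import Data.List.Base using (List; []; _∷_)
import Data.List.Membership.Propositional as List
import Data.Nat.Base as ℕ
open import Data.Nat.Base using (ℕ)
open import Data.Product.Base using (Σ; Σ-syntax; ∃-syntax; _×_; _,_; proj₁)
open import Data.Sum.Base using (_⊎_)
open import Data.Unit.Base using (⊤)
open import Data.Vec.Base using (Vec; []; _∷_; lookup)
open import Level using (0ℓ) renaming (suc to lsuc)
open import Relation.Binary.Core using (Rel)
open import Relation.Binary.PropositionalEquality.Core using (_≡_)
open import Relation.Nullary.Negation.Core using (¬_)
open import Relation.Unary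
  using (Pred; _∈_; _∩_; _∪_; _⇒_; ∁; U; ∅; Universal; _≐_)

Atom : Set
Atom = ℕ

data TemporalOp : Set where
  ○F ○P □F □P ◇F ◇P : TemporalOp

-- ops ▸ A is A prefixed with ops, the head of the list being outermost.
record PrefixedAtom : Set where
  constructor _▸_
  field
    prefix : List TemporalOp
    atom   : Atom

infixr 6 _∧′_
infixr 5 _∨′_
infixr 4 _→′_
infix  3 _↔′_

-- Boolean combinations of n given formulas.
data BoolComb (n : ℕ) : Set where
  part                     : Fin n → BoolComb n
  ⊤′ ⊥′                    : BoolComb n
  ¬′_                      : BoolComb n → BoolComb n
  _∧′_ _∨′_ _→′_ _↔′_      : BoolComb n → BoolComb n → BoolComb n

record KromFormula : Set where
  field
    arity   : ℕ
    arity≤2 : arity ℕ.≤ 2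
    parts   : Vec PrefixedAtom arity
    shape   : BoolComb arity

Ontology : Set
Ontology = List KromFormula

-- Sets of integers are arbitrary predicates and connectives are read naively;
-- this is the classical set-theoretic semantics once excluded middle is assumed.
Interpretation : Set₁
Interpretation = Atom → Pred ℤ 0ℓ

⟦_⟧ᵒ : TemporalOp → Pred ℤ 0ℓ → Pred ℤ 0ℓ
⟦ ○F ⟧ᵒ P n = n + 1ℤ ∈ P
⟦ ○P ⟧ᵒ P n = n - 1ℤ ∈ P
⟦ □F ⟧ᵒ P n = ∀ k → n < k → k ∈ P
⟦ □P ⟧ᵒ P n = ∀ k → k < n → k ∈ P
⟦ ◇F ⟧ᵒ P n = ∃[ k ] n < k × k ∈ P
⟦ ◇P ⟧ᵒ P n = ∃[ k ] k < n × k ∈ P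

⟦_⟧ᵖ : PrefixedAtom → Interpretation → Pred ℤ 0ℓ
⟦ []         ▸ A ⟧ᵖ 𝔐 = 𝔐 A
⟦ (op ∷ ops) ▸ A ⟧ᵖ 𝔐 = ⟦ op ⟧ᵒ (⟦ ops ▸ A ⟧ᵖ 𝔐)

⟦_⟧ᵇ : ∀ {n} → BoolComb n → (Fin n → Pred ℤ 0ℓ) → Pred ℤ 0ℓ
⟦ part i ⟧ᵇ ρ = ρ i
⟦ ⊤′     ⟧ᵇ ρ = U
⟦ ⊥′     ⟧ᵇ ρ = ∅
⟦ ¬′ φ   ⟧ᵇ ρ = ∁ (⟦ φ ⟧ᵇ ρ)
⟦ φ ∧′ ψ ⟧ᵇ ρ = ⟦ φ ⟧ᵇ ρ ∩ ⟦ ψ ⟧ᵇ ρ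
⟦ φ ∨′ ψ ⟧ᵇ ρ = ⟦ φ ⟧ᵇ ρ ∪ ⟦ ψ ⟧ᵇ ρ
⟦ φ →′ ψ ⟧ᵇ ρ = ⟦ φ ⟧ᵇ ρ ⇒ ⟦ ψ ⟧ᵇ ρ
⟦ φ ↔′ ψ ⟧ᵇ ρ = (⟦ φ ⟧ᵇ ρ ⇒ ⟦ ψ ⟧ᵇ ρ) ∩ (⟦ ψ ⟧ᵇ ρ ⇒ ⟦ φ ⟧ᵇ ρ)

⟦_⟧ : KromFormula → Interpretation → Pred ℤ 0ℓ
⟦ α ⟧ 𝔐 = ⟦ shape ⟧ᵇ (λ i → ⟦ lookup parts i ⟧ᵖ 𝔐)
  where open KromFormula α

record DataInstance : Set where
  field
    facts : List (Atom × ℤ)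

  OccursIn : Pred ℤ 0ℓ
  OccursIn n = ∃[ B ] (B , n) List.∈ facts

  field
    min max    : ℤ
    min-occurs : min ∈ OccursIn
    min-least  : ∀ n → n ∈ OccursIn → min ≤ n
    max-occurs : max ∈ OccursIn
    max-great  : ∀ n → n ∈ OccursIn → n ≤ max
    min≡0      : min ≡ 0ℤ
    1≤max      : 1ℤ ≤ max

  tem : Pred ℤ 0ℓ
  tem n = min ≤ n × n ≤ max

open DataInstance public using (tem)

_⊨ᴼ_ : Interpretation → Ontology → Set
𝔐 ⊨ᴼ 𝒪 = ∀ α → α List.∈ 𝒪 → Universal (⟦ α ⟧ 𝔐)

_⊨ᴬ_ : Interpretation → DataInstance → Set
𝔐 ⊨ᴬ 𝒜 = ∀ B n → (B , n) List.∈ DataInstance.facts 𝒜 → n ∈ 𝔐 B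

ans : Ontology → Atom → DataInstance → Pred ℤ (lsuc 0ℓ)
ans 𝒪 A 𝒜 n = n ∈ tem 𝒜 × (∀ 𝔐 → 𝔐 ⊨ᴼ 𝒪 → 𝔐 ⊨ᴬ 𝒜 → n ∈ 𝔐 A)

-- FO(<,≡)-formulas whose free variables are among n de Bruijn variables;
-- variables are the only terms.
data FO (n : ℕ) : Set where
  atomᶠ            : Atom → Fin n → FO n
  _<ᶠ_ _≈ᶠ_        : Fin n → Fin n → FO n
  _≡0mod_[_]       : Fin n → (m : ℕ) → 1 ℕ.< m → FO n
  ⊤ᶠ ⊥ᶠ            : FO n
  ¬ᶠ_              : FO n → FO n
  _∧ᶠ_ _∨ᶠ_ _→ᶠ_   : FO n → FO n → FO n
  ∀ᶠ_ ∃ᶠ_          : FO (ℕ.suc n) → FO n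

record Structure : Set₁ where
  field
    Dom      : Set
    unary    : Atom → Pred Dom 0ℓ
    less     : Rel Dom 0ℓ
    multiple : ℕ → Pred Dom 0ℓ

_,_⊨_ : ∀ {n} (𝔖 : Structure) → Vec (Structure.Dom 𝔖) n → FO n → Set
𝔖 , v ⊨ atomᶠ B x         = Structure.unary 𝔖 B (lookup v x)
𝔖 , v ⊨ (x <ᶠ y)          = Structure.less 𝔖 (lookup v x) (lookup v y)
𝔖 , v ⊨ (x ≈ᶠ y)          = lookup v x ≡ lookup v y
𝔖 , v ⊨ (x ≡0mod m [ _ ]) = Structure.multiple 𝔖 m (lookup v x)
𝔖 , v ⊨ ⊤ᶠ                = ⊤
𝔖 , v ⊨ ⊥ᶠ                = ⊥
𝔖 , v ⊨ (¬ᶠ φ)            = ¬ (𝔖 , v ⊨ φ)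
𝔖 , v ⊨ (φ ∧ᶠ ψ)          = (𝔖 , v ⊨ φ) × (𝔖 , v ⊨ ψ)
𝔖 , v ⊨ (φ ∨ᶠ ψ)          = (𝔖 , v ⊨ φ) ⊎ (𝔖 , v ⊨ ψ)
𝔖 , v ⊨ (φ →ᶠ ψ)          = (𝔖 , v ⊨ φ) → (𝔖 , v ⊨ ψ)
𝔖 , v ⊨ (∀ᶠ φ)            = ∀ d → 𝔖 , (d ∷ v) ⊨ φ
𝔖 , v ⊨ (∃ᶠ φ)            = ∃[ d ] 𝔖 , (d ∷ v) ⊨ φ

-- The domain pairs an integer with its membership proof; this proof is unique
-- because _≤_ on ℤ is proof-irrelevant.
𝔖[_] : DataInstance → Structure
𝔖[ 𝒜 ] = record
  { Dom      = Σ ℤ (tem 𝒜)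
  ; unary    = λ B d → (B , proj₁ d) List.∈ DataInstance.facts 𝒜
  ; less     = λ d e → proj₁ d < proj₁ e
  ; multiple = λ m d → + m ∣ proj₁ d
  }

answers : FO 1 → DataInstance → Pred ℤ 0ℓ
answers Q 𝒜 n = Σ[ n∈tem ∈ n ∈ tem 𝒜 ] 𝔖[ 𝒜 ] , ((n , n∈tem) ∷ []) ⊨ Q

_Rewrites⟨_,_⟩ : FO 1 → Ontology → Atom → Set₁
Q Rewrites⟨ 𝒪 , A ⟩ = ∀ 𝒜 → ans 𝒪 A 𝒜 ≐ answers Q 𝒜

{-# OPTIONS --safe #-}
module Submission where

-- Abstract each instant of a model to the Boolean values of the finitely many
-- suffixes of the parts of the axioms. Models become two-way infinite fair paths
-- in a finite graph, so ℓ is not an answer iff some path over the active domain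
-- fits the data, refutes A at ℓ, and extends to both sides, which depends on its
-- end states only. The values of □ and ◇ formulas are monotone in time, so the path
-- splits into a bounded number of segments on which they are constant. On such a
-- segment all remaining constraints are binary, hence preserved by majority, and by
-- Baker–Pixley a path that fits all the data exists as soon as, for any two instants,
-- there is one that fits the data at these two. The latter only asks which lengths
-- paths between given states can have, and those lengths are eventually periodic.

open import Defs
open import Axiom.ExcludedMiddle using (ExcludedMiddle)
open import Data.Bool.Base as Bool using (Bool; true; false; if_then_else_; not; _∧_; _∨_; f≤t; b≤b)
open import Data.Bool.Properties using (∧-zeroʳ; ∨-zeroʳ; not-involutive)
open import Data.Empty using (⊥-elim)
open import Data.Fin.Base as Fin using (Fin; zero; suc; toℕ; fromℕ<; funToFin; finToFun)
import Data.Fin.Properties as Finₚ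
open import Data.Integer.Base as ℤ using (ℤ; +_; -[1+_]; ∣_∣; 0ℤ; 1ℤ)
import Data.Integer.Properties as ℤₚ
open import Data.Integer.Tactic.RingSolver using (solve-∀)
open import Data.List.Base as List using (List; []; _∷_; concatMap; length; map)
open import Data.List.Membership.Propositional using (_∈_; lose)
open import Data.List.Membership.Propositional.Properties using (∈-concatMap⁺; ∈-concatMap⁻)
open import Data.List.Properties using (map-cong-local; length-map; ∷-injective)
import Data.List.Relation.Unary.All as All
open import Data.List.Relation.Unary.Any as Any using (here; there; index)
open import Data.List.Relation.Unary.Any.Properties using (lookup-index)
open import Data.Nat.Base using (ℕ; zero; suc; _+_; _*_; _∸_; _^_; _≤_; _<_; z≤n; s≤s; >-nonZero)
open import Data.Nat.DivMod using (_%_; _/_; m%n<n; m≡m%n+[m/n]*n)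
open import Data.Nat.Divisibility using (_∣_; divides; ∣m+n∣m⇒∣n; ∣m∣n⇒∣m+n; n∣m*n)
open import Data.Nat.Induction using (<-rec)
open import Data.Nat.Properties
import Data.Product.Base as Product
open import Data.Product.Base using (∃-syntax; ∃₂; _×_; _,_; proj₁; proj₂)
open import Data.Sum.Base as Sum using (_⊎_; inj₁; inj₂; [_,_]′)
open import Data.Unit.Base using (tt)
open import Data.Vec.Base as Vec using (Vec; []; _∷_; lookup)
open import Data.Vec.Membership.Propositional.Properties using (∈-lookup; ∈-toList⁺)
open import Function.Base using (_∘_; id; const)
open import Function.Bundles using (Inverse; _⇔_; mk⇔; module Equivalence)
open import Level using (0ℓ)
open import Relation.Binary.Core using (Rel)
open import Relation.Binary.PropositionalEquality
open import Relation.Nullary using (Dec; yes; no; does; contradiction; ¬_)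
import Relation.Nullary.Decidable as Dec
open import Relation.Unary using (Pred)

open Equivalence using (to; from)

-- A path over the active domain is a second-order object, while the formula may quantify over
-- instants only; this is the obstacle. A condition on two instants z ≤ w between the ends x and y
-- is first-order, because it speaks of three distances only, and congruences express membership of
-- a distance in an eventually periodic set. Majority needs each constraint to be decided by
-- agreement on two values. An axiom has at most two parts and ○ relates two values, but the
-- unfolding a = b′ ∧ a′ of □ relates three; once a and a′ are fixed, it is a condition on b′ alone.
-- Each step that changes some □ or ◇ value turns at least one gauge from false to true and none
-- back, so the size of the closure bounds the number of such steps. Unfolding alone would allow a ◇
-- formula to stay true for ever with no witness; fairness is therefore imposed on both half-lines.
-- Excluded middle settles every question that does not depend on the data, such as which states
-- have fair continuations, and the answers are built into the formula as truth constants.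

TwoOf : Set → Set → Set → Set
TwoOf P Q R = P × Q ⊎ P × R ⊎ Q × R

common : ∀ {P Q R P′ Q′ R′} → TwoOf P Q R → TwoOf P′ Q′ R′ → P × P′ ⊎ Q × Q′ ⊎ R × R′
common (inj₁ (p , q))        (inj₁ (p′ , q′))        = inj₁ (p , p′)
common (inj₁ (p , q))        (inj₂ (inj₁ (p′ , r′))) = inj₁ (p , p′)
common (inj₁ (p , q))        (inj₂ (inj₂ (q′ , r′))) = inj₂ (inj₁ (q , q′))
common (inj₂ (inj₁ (p , r))) (inj₁ (p′ , q′))        = inj₁ (p , p′)
common (inj₂ (inj₁ (p , r))) (inj₂ (inj₁ (p′ , r′))) = inj₁ (p , p′)
common (inj₂ (inj₁ (p , r))) (inj₂ (inj₂ (q′ , r′))) = inj₂ (inj₂ (r , r′))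
common (inj₂ (inj₂ (q , r))) (inj₁ (p′ , q′))        = inj₂ (inj₁ (q , q′))
common (inj₂ (inj₂ (q , r))) (inj₂ (inj₁ (p′ , r′))) = inj₂ (inj₂ (r , r′))
common (inj₂ (inj₂ (q , r))) (inj₂ (inj₂ (q′ , r′))) = inj₂ (inj₁ (q , q′))

-- Majority on Booleans.

maj : Bool → Bool → Bool → Bool
maj true  b c = b ∨ c
maj false b c = b ∧ c

maj-agrees : ∀ a b c → TwoOf (a ≡ maj a b c) (b ≡ maj a b c) (c ≡ maj a b c)
maj-agrees true  true  c     = inj₁ (refl , refl)
maj-agrees true  false true  = inj₂ (inj₁ (refl , refl))
maj-agrees true  false false = inj₂ (inj₂ (refl , refl))
maj-agrees false false c     = inj₁ (refl , refl)
maj-agrees false true  false = inj₂ (inj₁ (refl , refl))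
maj-agrees false true  true  = inj₂ (inj₂ (refl , refl))

maj-idem : ∀ a → maj a a a ≡ a
maj-idem true  = refl
maj-idem false = refl

maj-true : ∀ {a b c} → TwoOf (a ≡ true) (b ≡ true) (c ≡ true) → maj a b c ≡ true
maj-true {a} {b} {c} two with common two (maj-agrees a b c)
... | inj₁ (a≡true , a≡m)        = trans (sym a≡m) a≡true
... | inj₂ (inj₁ (b≡true , b≡m)) = trans (sym b≡m) b≡true
... | inj₂ (inj₂ (c≡true , c≡m)) = trans (sym c≡m) c≡true

-- Two majorities of three are attained together by one of the three, so any
-- constraint on at most two Booleans is preserved by majority.
maj-overlap : ∀ {n} → n ≤ 2 → (u v w : Fin n → Bool) → let m = λ i → maj (u i) (v i) (w i) in
              (∀ i → u i ≡ m i) ⊎ (∀ i → v i ≡ m i) ⊎ (∀ i → w i ≡ m i)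
maj-overlap z≤n             u v w = inj₁ λ ()
maj-overlap (s≤s z≤n)       u v w with maj-agrees (u zero) (v zero) (w zero)
... | inj₁ (e , _)        = inj₁ λ { zero → e }
... | inj₂ (inj₁ (e , _)) = inj₁ λ { zero → e }
... | inj₂ (inj₂ (e , _)) = inj₂ (inj₁ λ { zero → e })
maj-overlap (s≤s (s≤s z≤n)) u v w
  with common (maj-agrees (u zero) (v zero) (w zero))
              (maj-agrees (u (suc zero)) (v (suc zero)) (w (suc zero)))
... | inj₁ (e , e′)        = inj₁ λ { zero → e ; (suc zero) → e′ }
... | inj₂ (inj₁ (e , e′)) = inj₂ (inj₁ λ { zero → e ; (suc zero) → e′ })
... | inj₂ (inj₂ (e , e′)) = inj₂ (inj₂ λ { zero → e ; (suc zero) → e′ })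

-- Coding Boolean vectors by numbers.

funToFin-cong : ∀ {m n} {f g : Fin m → Fin n} → f ≗ g → funToFin f ≡ funToFin g
funToFin-cong {zero}  f≗g = refl
funToFin-cong {suc m} f≗g = cong₂ Fin.combine (f≗g zero) (funToFin-cong (f≗g ∘ suc))

abstract

  -- Coding turns pointwise equality into equality and places the vectors in a finite initial
  -- segment of ℕ, as the pigeonhole principle, finite disjunctions over states and idempotence of
  -- majority require.
  encode : ∀ {n} → (Fin n → Bool) → Fin (2 ^ n)
  encode f = funToFin (Inverse.from Finₚ.2↔Bool ∘ f)

  decode : ∀ n → Fin (2 ^ n) → Fin n → Bool
  decode n c i = Inverse.to Finₚ.2↔Bool (finToFun c i)

  decode-encode : ∀ {n} (f : Fin n → Bool) i → decode n (encode f) i ≡ f i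
  decode-encode {n} f i = trans (cong (Inverse.to Finₚ.2↔Bool) (Finₚ.finToFun-funToFin _ i))
                            (Inverse.strictlyInverseˡ Finₚ.2↔Bool (f i))

  encode-cong : ∀ {n} {f g : Fin n → Bool} → f ≗ g → encode f ≡ encode g
  encode-cong f≗g = funToFin-cong (λ i → cong (Inverse.from Finₚ.2↔Bool) (f≗g i))

  encode-decode : ∀ {n} (c : Fin (2 ^ n)) → encode (decode n c) ≡ c
  encode-decode {n} c = trans (funToFin-cong {n} λ i → Inverse.strictlyInverseʳ Finₚ.2↔Bool (finToFun c i))
                              (Finₚ.funToFin-finToFin {n} c)

-- Paths in a graph and the Baker-Pixley argument.

module Walks {S : Set} (E : Rel S 0ℓ) where

  record Run (P : ℕ → S → Set) (x y : ℕ) (r : ℕ → S) : Set where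
    field
      holds : ∀ i → x ≤ i → i ≤ y → P i (r i)
      steps : ∀ i → x ≤ i → i < y → E (r i) (r (suc i))

  open Run public

  -- Positions are absolute rather than counted from the start of the walk, because the data to be
  -- fitted depend on them.
  Walk : (ℕ → S → Set) → ℕ → S → ℕ → S → Set
  Walk P x s y t = x ≤ y × ∃[ r ] r x ≡ s × r y ≡ t × Run P x y r

  restrict : ∀ {P x y z w r} → x ≤ z → w ≤ y → Run P x y r → Run P z w r
  restrict x≤z w≤y R = record
    { holds = λ i z≤i i≤w → holds R i (≤-trans x≤z z≤i) (≤-trans i≤w w≤y)
    ; steps = λ i z≤i i<w → steps R i (≤-trans x≤z z≤i) (<-≤-trans i<w w≤y)
    }

  map-run : ∀ {P Q x y r} → (∀ i → x ≤ i → i ≤ y → P i (r i) → Q i (r i)) → Run P x y r → Run Q x y r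
  map-run f R = record
    { holds = λ i x≤i i≤y → f i x≤i i≤y (holds R i x≤i i≤y)
    ; steps = steps R
    }

  map-walk : ∀ {P Q x s y t} → (∀ i {u} → P i u → Q i u) → Walk P x s y t → Walk Q x s y t
  map-walk f (x≤y , r , rx , ry , R) = x≤y , r , rx , ry , map-run (λ i _ _ → f i) R

  abstract

    splice : ℕ → (ℕ → S) → (ℕ → S) → ℕ → S
    splice z f g i with i ≤? z
    ... | yes _ = f i
    ... | no _  = g i

    splice-≤ : ∀ {z f g i} → i ≤ z → splice z f g i ≡ f i
    splice-≤ {z} {i = i} i≤z with i ≤? z
    ... | yes _  = refl
    ... | no i≰z = contradiction i≤z i≰z

    splice-> : ∀ {z f g i} → z < i → splice z f g i ≡ g i
    splice-> {z} {i = i} z<i with i ≤? z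
    ... | yes i≤z = contradiction z<i (≤⇒≯ i≤z)
    ... | no _    = refl

  splice-≥ : ∀ {z f g i} → f z ≡ g z → z ≤ i → splice z f g i ≡ g i
  splice-≥ fz≡gz z≤i with m≤n⇒m<n∨m≡n z≤i
  ... | inj₁ z<i  = splice-> z<i
  ... | inj₂ refl = trans (splice-≤ ≤-refl) fz≡gz

  splice-run : ∀ {z f g P x y} → f z ≡ g z → Run P x z f → Run P z y g → Run P x y (splice z f g)
  splice-run {z} {f} {g} {P} {x} {y} fz≡gz F G = record { holds = holds′ ; steps = steps′ }
    where
    holds′ : ∀ i → x ≤ i → i ≤ y → P i (splice z f g i)
    holds′ i x≤i i≤y with ≤-total i z
    ... | inj₁ i≤z = subst (P i) (sym (splice-≤ i≤z)) (holds F i x≤i i≤z)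
    ... | inj₂ z≤i = subst (P i) (sym (splice-≥ fz≡gz z≤i)) (holds G i z≤i i≤y)
    steps′ : ∀ i → x ≤ i → i < y → E (splice z f g i) (splice z f g (suc i))
    steps′ i x≤i i<y with <-≤-connex i z
    ... | inj₁ i<z = subst₂ E (sym (splice-≤ (<⇒≤ i<z))) (sym (splice-≤ i<z)) (steps F i x≤i i<z)
    ... | inj₂ z≤i = subst₂ E (sym (splice-≥ fz≡gz z≤i)) (sym (splice-> (s≤s z≤i))) (steps G i z≤i i<y)

  walk-refl : ∀ {P x s} → P x s → Walk P x s x s
  walk-refl {P} {x} {s} p = ≤-refl , const s , refl , refl , record
    { holds = λ i x≤i i≤x → subst (λ j → P j s) (≤-antisym x≤i i≤x) p
    ; steps = λ i x≤i i<x → contradiction i<x (≤⇒≯ x≤i)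
    }

  walk-trans : ∀ {P x s z u y t} → Walk P x s z u → Walk P z u y t → Walk P x s y t
  walk-trans {z = z} (x≤z , f , fx , fz , F) (z≤y , g , gz , gy , G) =
    ≤-trans x≤z z≤y , splice z f g , trans (splice-≤ x≤z) fx , trans (splice-≥ fz≡gz z≤y) gy ,
    splice-run fz≡gz F G
    where fz≡gz = trans fz (sym gz)

  cons : ∀ {P x s u y t} → P x s → E s u → Walk P (suc x) u y t → Walk P x s y t
  cons {P} {x} {s} {u} {y} p e (x<y , g , gx , gy , G) =
    <⇒≤ x<y , splice x (const s) g , splice-≤ ≤-refl , trans (splice-> x<y) gy ,
    record { holds = holds′ ; steps = steps′ }
    where
    r = splice x (const s) g
    holds′ : ∀ i → x ≤ i → i ≤ y → P i (r i)
    holds′ i x≤i i≤y with m≤n⇒m<n∨m≡n x≤i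
    ... | inj₁ x<i  = subst (P i) (sym (splice-> x<i)) (holds G i x<i i≤y)
    ... | inj₂ refl = subst (P x) (sym (splice-≤ {f = const s} {g} ≤-refl)) p
    steps′ : ∀ i → x ≤ i → i < y → E (r i) (r (suc i))
    steps′ i x≤i i<y with m≤n⇒m<n∨m≡n x≤i
    ... | inj₁ x<i  = subst₂ E (sym (splice-> x<i)) (sym (splice-> (m≤n⇒m≤1+n x<i))) (steps G i x<i i<y)
    ... | inj₂ refl = subst₂ E (sym (splice-≤ {f = const s} {g} ≤-refl)) (sym (trans (splice-> ≤-refl) gx)) e

  head : ∀ {P x s y t} → Walk P x s y t → P x s
  head {P} {x} (x≤y , r , refl , _ , R) = holds R x ≤-refl x≤y

  uncons : ∀ {P x s y t} → x < y → Walk P x s y t → ∃[ u ] E s u × Walk P (suc x) u y t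
  uncons {x = x} x<y (_ , r , refl , ry , R) =
    r (suc x) , steps R x ≤-refl x<y , x<y , r , refl , ry , restrict (n≤1+n x) ≤-refl R

  stationary : ∀ {P x s t} → Walk P x s x t → s ≡ t
  stationary (_ , r , rx , ry , _) = trans (sym rx) ry

  -- The position-free form of a walk: by recursion on the length, so that passing from `k` to
  -- `suc k` is one fixed operation on sets of states, to which periodicity applies.
  Steps : (S → Set) → ℕ → S → S → Set
  Steps V zero    s t = V s × s ≡ t
  Steps V (suc k) s t = V s × ∃[ u ] E s u × Steps V k u t

  steps⇒walk : ∀ {V x s t} k → Steps V k s t → Walk (λ _ → V) x s (k + x) t
  steps⇒walk zero    (v , refl)      = walk-refl v
  steps⇒walk {V} {x} {s} {t} (suc k) (v , u , e , σ) =
    cons v e (subst (λ y → Walk (λ _ → V) (suc x) u y t) (+-suc k x) (steps⇒walk k σ))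

  walk⇒steps : ∀ {V x s t} k → Walk (λ _ → V) x s (k + x) t → Steps V k s t
  walk⇒steps zero w = head w , stationary w
  walk⇒steps {V} {x} {s} {t} (suc k) w with u , e , w′ ← uncons (s≤s (m≤n+m x k)) w =
    head w , u , e , walk⇒steps k (subst (λ y → Walk (λ _ → V) (suc x) u y t) (sym (+-suc k x)) w′)

  -- The data `F` are imposed at `z` and `w` only. The three walks in between must merely stay in
  -- `V`, hence depend on nothing but their lengths.
  Linked : (S → Set) → (ℕ → S → Set) → ℕ → S → ℕ → S → ℕ → ℕ → Set
  Linked V F x s y t z w = ∃₂ λ u v → F z u × F w v ×
    Walk (λ _ → V) x s z u × Walk (λ _ → V) z u w v × Walk (λ _ → V) w v y t

  walk⇒linked : ∀ {V F x s y t} → Walk (λ i u → V u × F i u) x s y t →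
                ∀ z w → x ≤ z → z ≤ w → w ≤ y → Linked V F x s y t z w
  walk⇒linked {V} {F} {x} {s} {y} {t} (x≤y , r , rx , ry , R) z w x≤z z≤w w≤y =
    r z , r w , proj₂ (holds R z x≤z z≤y) , proj₂ (holds R w x≤w w≤y) ,
    (x≤z , r , rx , refl , restrict ≤-refl z≤y R′) ,
    (z≤w , r , refl , refl , restrict x≤z w≤y R′) ,
    (w≤y , r , refl , ry , restrict x≤w ≤-refl R′)
    where
    x≤w = ≤-trans x≤z z≤w
    z≤y = ≤-trans z≤w w≤y
    R′ = map-run (λ _ _ _ → proj₁) R

  -- `m` is a near-unanimity operation. Compatibility with edges is asked for inside `V` only, since
  -- unfolding is respected by majority only among states with common □ and ◇ values.
  module Helly
    (V : S → Set) (F : ℕ → S → Set) (m : S → S → S → S)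
    (m-idem : ∀ s → m s s s ≡ s)
    (m-V : ∀ {a b c} → V a → V b → V c → V (m a b c))
    (m-E : ∀ {a b c a′ b′ c′} → V a → V b → V c → V a′ → V b′ → V c′ →
           E a a′ → E b b′ → E c c′ → E (m a b c) (m a′ b′ c′))
    (m-F : ∀ {i a b c} → TwoOf (F i a) (F i b) (F i c) → F i (m a b c))
    where

    -- Baker–Pixley: runs that fit the data at two given positions and at all
    -- positions below n combine by majority into one that also fits at n.
    linked⇒walk : ∀ {x s y t} → x ≤ y →
                  (∀ z w → x ≤ z → z ≤ w → w ≤ y → Linked V F x s y t z w) →
                  Walk (λ i u → V u × F i u) x s y t
    linked⇒walk {x} {s} {y} {t} x≤y link =
      -- Once all positions below `suc y` are covered, the two designated positions carry no further
      -- information; any position of the range serves for them.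
      let r , (rx , ry , R) , _ , _ , fits = fitting (suc y) x x ≤-refl x≤y ≤-refl x≤y in
      x≤y , r , rx , ry , record
        { holds = λ i x≤i i≤y → holds R i x≤i i≤y , fits i x≤i i≤y (s≤s i≤y)
        ; steps = steps R
        }
      where
      Free : (ℕ → S) → Set
      Free r = r x ≡ s × r y ≡ t × Run (λ _ → V) x y r

      ordered : ∀ z w → x ≤ z → z ≤ w → w ≤ y → ∃[ r ] Free r × F z (r z) × F w (r w)
      ordered z w x≤z z≤w w≤y
        with u , v , Fu , Fv , (_ , f , fx , fz , Rf) , (_ , g , gz , gw , Rg) , (_ , h , hw , hy , Rh)
               ← link z w x≤z z≤w w≤y =
        r , (trans (splice-≤ x≤z) fx ,
             trans (splice-≥ fz≡ (≤-trans z≤w w≤y)) (trans (splice-≥ gw≡ w≤y) hy) ,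
             splice-run fz≡ Rf (splice-run gw≡ Rg Rh)) ,
        subst (F z) (sym (trans (splice-≤ ≤-refl) fz)) Fu ,
        subst (F w) (sym (trans (splice-≥ fz≡ z≤w) (trans (splice-≤ ≤-refl) gw))) Fv
        where
        gw≡ = trans gw (sym hw)
        fz≡ = trans fz (sym (trans (splice-≤ z≤w) gz))
        r = splice z f (splice w g h)

      pair : ∀ a b → x ≤ a → a ≤ y → x ≤ b → b ≤ y → ∃[ r ] Free r × F a (r a) × F b (r b)
      pair a b x≤a a≤y x≤b b≤y with ≤-total a b
      ... | inj₁ a≤b = ordered a b x≤a a≤b b≤y
      ... | inj₂ b≤a = let r , free , Fb , Fa = ordered b a x≤b b≤a a≤y in r , free , Fa , Fb

      _⟨m⟩_,_ : (ℕ → S) → (ℕ → S) → (ℕ → S) → ℕ → S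
      (f ⟨m⟩ g , h) i = m (f i) (g i) (h i)

      free-m : ∀ {f g h} → Free f → Free g → Free h → Free (f ⟨m⟩ g , h)
      free-m {f} {g} {h} (refl , refl , Rf) (gx , gy , Rg) (hx , hy , Rh) =
        trans (cong₂ (m (f x)) gx hx) (m-idem _) ,
        trans (cong₂ (m (f y)) gy hy) (m-idem _) ,
        record
          { holds = λ i p q → m-V (holds Rf i p q) (holds Rg i p q) (holds Rh i p q)
          ; steps = λ i p q → let p′ = m≤n⇒m≤1+n p ; q′ = <⇒≤ q in
              m-E (holds Rf i p q′) (holds Rg i p q′) (holds Rh i p q′)
                  (holds Rf (suc i) p′ q) (holds Rg (suc i) p′ q) (holds Rh (suc i) p′ q)
                  (steps Rf i p q) (steps Rg i p q) (steps Rh i p q)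
          }

      -- The designated positions vary because the induction step uses all three pairs out of `a`,
      -- `b` and `n`: each of these is then met by two of the three runs, and every earlier position
      -- by all of them.
      fitting : ∀ n a b → x ≤ a → a ≤ y → x ≤ b → b ≤ y →
                ∃[ r ] Free r × F a (r a) × F b (r b) × (∀ i → x ≤ i → i ≤ y → i < n → F i (r i))
      fitting zero a b x≤a a≤y x≤b b≤y =
        let r , free , Fa , Fb = pair a b x≤a a≤y x≤b b≤y in r , free , Fa , Fb , λ _ _ _ ()
      fitting (suc n) a b x≤a a≤y x≤b b≤y with x ≤? n | n ≤? y
      ... | yes x≤n | yes n≤y
        with f , Ff , fa , fb , ft ← fitting n a b x≤a a≤y x≤b b≤y
           | g , Fg , ga , gn , gt ← fitting n a n x≤a a≤y x≤n n≤y
           | h , Fh , hb , hn , ht ← fitting n b n x≤b b≤y x≤n n≤y =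
        (f ⟨m⟩ g , h) , free-m Ff Fg Fh , m-F (inj₁ (fa , ga)) , m-F (inj₂ (inj₁ (fb , hb))) , fits
        where
        fits : ∀ i → x ≤ i → i ≤ y → i < suc n → F i ((f ⟨m⟩ g , h) i)
        fits i x≤i i≤y (s≤s i≤n) with m≤n⇒m<n∨m≡n i≤n
        ... | inj₁ i<n  = m-F (inj₁ (ft i x≤i i≤y i<n , gt i x≤i i≤y i<n))
        ... | inj₂ refl = m-F (inj₂ (inj₂ (gn , hn)))
      ... | no x≰n | _ = let r , free , Fa , Fb , fits = fitting n a b x≤a a≤y x≤b b≤y in
        r , free , Fa , Fb , λ { i x≤i i≤y (s≤s i≤n) → contradiction (≤-trans x≤i i≤n) x≰n }
      ... | yes _ | no n≰y = let r , free , Fa , Fb , fits = fitting n a b x≤a a≤y x≤b b≤y in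
        r , free , Fa , Fb , λ { i x≤i i≤y (s≤s i≤n) →
          fits i x≤i i≤y (≤∧≢⇒< i≤n λ { refl → n≰y i≤y }) }

-- The active domain as an initial segment of ℕ.

module Domain (𝒜 : DataInstance) where
  open DataInstance 𝒜 using (max; min≡0; 1≤max; facts)

  Dom : Set
  Dom = Structure.Dom 𝔖[ 𝒜 ]

  last : ℕ
  last = ∣ max ∣

  +last : + last ≡ max
  +last = ℤₚ.0≤i⇒+∣i∣≡i (ℤₚ.≤-trans (ℤ.+≤+ z≤n) 1≤max)

  pos : Dom → ℕ
  pos (n , _) = ∣ n ∣

  +pos : ∀ d → + pos d ≡ proj₁ d
  +pos (n , min≤n , _) = ℤₚ.0≤i⇒+∣i∣≡i (subst (ℤ._≤ n) min≡0 min≤n)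

  pos≤last : ∀ d → pos d ≤ last
  pos≤last d@(n , _ , n≤max) = ℤₚ.drop‿+≤+ (subst₂ ℤ._≤_ (sym (+pos d)) (sym +last) n≤max)

  element : ∀ {i} → i ≤ last → ∃[ d ] pos d ≡ i
  element {i} i≤last =
    (+ i , subst (ℤ._≤ + i) (sym min≡0) (ℤ.+≤+ z≤n) , subst (+ i ℤ.≤_) +last (ℤ.+≤+ i≤last)) , refl

  below : ∀ d {i} → i ≤ pos d → ∃[ e ] pos e ≡ i
  below d i≤d = element (≤-trans i≤d (pos≤last d))

  pos-< : ∀ d e → (proj₁ d ℤ.< proj₁ e) ⇔ (pos d < pos e)
  pos-< d e = mk⇔ (λ d<e → ℤₚ.drop‿+<+ (subst₂ ℤ._<_ (sym (+pos d)) (sym (+pos e)) d<e))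
                  (λ d<e → subst₂ ℤ._<_ (+pos d) (+pos e) (ℤ.+<+ d<e))

  Data : ℕ → Atom → Set
  Data i B = (B , + i) ∈ facts

  data-pos : ∀ d B → ((B , proj₁ d) ∈ facts) ⇔ Data (pos d) B
  data-pos d B = mk⇔ (subst (λ n → (B , n) ∈ facts) (sym (+pos d)))
                     (subst (λ n → (B , n) ∈ facts) (+pos d))

-- Distances and congruences in FO(<,≡).

_≤ᶠ_ : ∀ {n} → Fin n → Fin n → FO n
x ≤ᶠ y = ¬ᶠ (y <ᶠ x)

successorᶠ : ∀ {n} → Fin n → Fin n → FO n
successorᶠ x y = (x <ᶠ y) ∧ᶠ (¬ᶠ (∃ᶠ ((suc x <ᶠ zero) ∧ᶠ (zero <ᶠ suc y))))

-- Distance 0 is expressed by two inequalities rather than by `≈ᶠ`, since elements of the domain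
-- carry membership proofs and only their positions should count.
offsetᶠ : ∀ {n} → ℕ → Fin n → Fin n → FO n
offsetᶠ zero    x y = (x ≤ᶠ y) ∧ᶠ (y ≤ᶠ x)
offsetᶠ (suc k) x y = ∃ᶠ (offsetᶠ k (suc x) zero ∧ᶠ successorᶠ zero (suc y))

⋁ : ∀ {n} k → (Fin k → FO n) → FO n
⋁ zero    φ = ⊥ᶠ
⋁ (suc k) φ = φ zero ∨ᶠ ⋁ k (φ ∘ suc)

-- Divisibility is available for single positions only. Congruence is thus witnessed by a common
-- remainder `i` and the two multiples of `p` that lie `i` below `x` and `y`; for the true remainder
-- these multiples are not negative and so belong to the active domain.
congruentᶠ : ∀ {n} p → 1 < p → Fin n → Fin n → FO n
congruentᶠ p 1<p x y = ⋁ p λ i → ∃ᶠ ∃ᶠ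
  ((((suc zero ≡0mod p [ 1<p ]) ∧ᶠ (zero ≡0mod p [ 1<p ])) ∧ᶠ
    offsetᶠ (toℕ i) (suc zero) (suc (suc x))) ∧ᶠ offsetᶠ (toℕ i) zero (suc (suc y)))

firstᶠ lastᶠ : ∀ {n} → Fin n → FO n
firstᶠ x = ∀ᶠ (suc x ≤ᶠ zero)
lastᶠ  x = ∀ᶠ (zero ≤ᶠ suc x)

module Meaning (𝒜 : DataInstance) where
  open Domain 𝒜

  infix 3 _⊩_
  _⊩_ : ∀ {n} → Vec Dom n → FO n → Set
  v ⊩ φ = 𝔖[ 𝒜 ] , v ⊨ φ

  ⊩-≤ : ∀ {n} (v : Vec Dom n) x y → (v ⊩ x ≤ᶠ y) ⇔ (pos (lookup v x) ≤ pos (lookup v y))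
  ⊩-≤ v x y = mk⇔ (λ y≮x → ≮⇒≥ (y≮x ∘ from y<x)) (λ x≤y → ≤⇒≯ x≤y ∘ to y<x)
    where y<x = pos-< (lookup v y) (lookup v x)

  ⊩-successor : ∀ {n} (v : Vec Dom n) x y →
                (v ⊩ successorᶠ x y) ⇔ (pos (lookup v y) ≡ suc (pos (lookup v x)))
  ⊩-successor v x y = mk⇔ forth back
    where
    d = lookup v x
    e = lookup v y
    forth : v ⊩ successorᶠ x y → pos e ≡ suc (pos d)
    forth (d<e , nothing-between) with m≤n⇒m<n∨m≡n (to (pos-< d e) d<e)
    ... | inj₂ 1+d≡e = sym 1+d≡e
    ... | inj₁ 1+d<e with f , f≡1+d ← below e (<⇒≤ 1+d<e) =
      contradiction (f , from (pos-< d f) (subst (pos d <_) (sym f≡1+d) ≤-refl) ,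
                         from (pos-< f e) (subst (_< pos e) (sym f≡1+d) 1+d<e))
                    nothing-between
    back : pos e ≡ suc (pos d) → v ⊩ successorᶠ x y
    back e≡1+d = from (pos-< d e) (subst (pos d <_) (sym e≡1+d) ≤-refl) ,
      λ (f , d<f , f<e) → contradiction (to (pos-< d f) d<f)
        (≤⇒≯ (≤-pred (subst (pos f <_) e≡1+d (to (pos-< f e) f<e))))

  ⊩-offset : ∀ {n} (v : Vec Dom n) k x y →
             (v ⊩ offsetᶠ k x y) ⇔ (pos (lookup v y) ≡ k + pos (lookup v x))
  ⊩-offset v zero x y = mk⇔
    (λ (x≤y , y≤x) → ≤-antisym (to (⊩-≤ v y x) y≤x) (to (⊩-≤ v x y) x≤y))
    (λ y≡x → from (⊩-≤ v x y) (≤-reflexive (sym y≡x)) , from (⊩-≤ v y x) (≤-reflexive y≡x))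
  ⊩-offset v (suc k) x y = mk⇔
    (λ (d , x+k≡d , 1+d≡y) → trans (to (⊩-successor (d ∷ v) zero (suc y)) 1+d≡y)
                                   (cong suc (to (⊩-offset (d ∷ v) k (suc x) zero) x+k≡d)))
    (λ y≡ → let d , d≡ = below (lookup v y) (≤-trans (n≤1+n _) (≤-reflexive (sym y≡))) in
      d , from (⊩-offset (d ∷ v) k (suc x) zero) d≡ ,
          from (⊩-successor (d ∷ v) zero (suc y)) (trans y≡ (cong suc (sym d≡))))

  ⊩-⋁ : ∀ {n} (v : Vec Dom n) k φ → (v ⊩ ⋁ k φ) ⇔ (∃[ i ] (v ⊩ φ i))
  ⊩-⋁ v zero    φ = mk⇔ (λ ()) (λ ())
  ⊩-⋁ v (suc k) φ = mk⇔
    (λ { (inj₁ h) → zero , h ; (inj₂ h) → let i , h′ = to (⊩-⋁ v k (φ ∘ suc)) h in suc i , h′ })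
    (λ { (zero , h) → inj₁ h ; (suc i , h) → inj₂ (from (⊩-⋁ v k (φ ∘ suc)) (i , h)) })

  ⊩-congruent : ∀ {n} (v : Vec Dom n) p 1<p x y q → pos (lookup v y) ≡ q + pos (lookup v x) →
                (v ⊩ congruentᶠ p 1<p x y) ⇔ p ∣ q
  ⊩-congruent v p 1<p x y q y≡q+x = mk⇔ forth back
    where
    instance _ = >-nonZero (<⇒≤ 1<p)
    a = pos (lookup v x)
    forth : v ⊩ congruentᶠ p 1<p x y → p ∣ q
    forth h with i , w , w′ , ((p∣w , p∣w′) , w≡) , w′≡ ← to (⊩-⋁ v p _) h =
      ∣m+n∣m⇒∣n (subst (p ∣_) w′≡w+q p∣w′) p∣w
      where
      V = w′ ∷ w ∷ v
      w′≡w+q : pos w′ ≡ pos w + q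
      w′≡w+q = +-cancelˡ-≡ (toℕ i) _ _ (begin
        toℕ i + pos w′        ≡⟨ to (⊩-offset V (toℕ i) zero (suc (suc y))) w′≡ ⟨
        pos (lookup v y)      ≡⟨ y≡q+x ⟩
        q + a                 ≡⟨ cong (_+_ q) (to (⊩-offset V (toℕ i) (suc zero) (suc (suc x))) w≡) ⟩
        q + (toℕ i + pos w)   ≡⟨ +-comm q _ ⟩
        toℕ i + pos w + q     ≡⟨ +-assoc (toℕ i) _ _ ⟩
        toℕ i + (pos w + q)   ∎)
        where open ≡-Reasoning
    back : p ∣ q → v ⊩ congruentᶠ p 1<p x y
    back p∣q = from (⊩-⋁ v p _) (i , w , w′ ,
      ((subst (p ∣_) (sym w≡) (n∣m*n (a / p)) ,
        subst (p ∣_) (sym w′≡) (∣m∣n⇒∣m+n p∣q (n∣m*n (a / p)))) ,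
       from (⊩-offset V (toℕ i) (suc zero) (suc (suc x)))
         (trans a≡ (cong₂ _+_ (sym i≡) (sym w≡)))) ,
      from (⊩-offset V (toℕ i) zero (suc (suc y))) (begin
        pos (lookup v y)           ≡⟨ y≡ ⟩
        a % p + (q + a / p * p)    ≡⟨ cong₂ _+_ i≡ w′≡ ⟨
        toℕ i + pos w′             ∎))
      where
      open ≡-Reasoning
      i = fromℕ< (m%n<n a p)
      i≡ : toℕ i ≡ a % p
      i≡ = Finₚ.toℕ-fromℕ< _
      a≡ : a ≡ a % p + a / p * p
      a≡ = m≡m%n+[m/n]*n a p
      y≡ : pos (lookup v y) ≡ a % p + (q + a / p * p)
      y≡ = begin
        pos (lookup v y)           ≡⟨ y≡q+x ⟩
        q + a                      ≡⟨ cong (_+_ q) a≡ ⟩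
        q + (a % p + a / p * p)    ≡⟨ +-assoc q _ _ ⟨
        q + a % p + a / p * p      ≡⟨ cong (_+ a / p * p) (+-comm q _) ⟩
        a % p + q + a / p * p      ≡⟨ +-assoc (a % p) _ _ ⟩
        a % p + (q + a / p * p)    ∎
      below-x = below (lookup v x) (≤-trans (m≤n+m (a / p * p) (a % p)) (≤-reflexive (sym a≡)))
      below-y = below (lookup v y) (≤-trans (m≤n+m (q + a / p * p) (a % p)) (≤-reflexive (sym y≡)))
      w = proj₁ below-x
      w≡ = proj₂ below-x
      w′ = proj₁ below-y
      w′≡ = proj₂ below-y
      V = w′ ∷ w ∷ v

  ⊩-first : ∀ {n} (v : Vec Dom n) x → (v ⊩ firstᶠ x) ⇔ (pos (lookup v x) ≡ 0)
  ⊩-first v x = mk⇔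
    (λ h → let d , d≡0 = element z≤n in
      n≤0⇒n≡0 (subst (pos (lookup v x) ≤_) d≡0 (to (⊩-≤ (d ∷ v) (suc x) zero) (h d))))
    (λ x≡0 d → from (⊩-≤ (d ∷ v) (suc x) zero) (subst (_≤ pos d) (sym x≡0) z≤n))

  ⊩-last : ∀ {n} (v : Vec Dom n) x → (v ⊩ lastᶠ x) ⇔ (pos (lookup v x) ≡ last)
  ⊩-last v x = mk⇔
    (λ h → let d , d≡last = element ≤-refl in
      ≤-antisym (pos≤last (lookup v x))
                (subst (_≤ pos (lookup v x)) d≡last (to (⊩-≤ (d ∷ v) zero (suc x)) (h d))))
    (λ x≡last d → from (⊩-≤ (d ∷ v) zero (suc x)) (subst (pos d ≤_) (sym x≡last) (pos≤last d)))

-- Eventually periodic sets of distances and their definability.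

module Classical (em : ExcludedMiddle 0ℓ) where

  ⌊_⌋ : Set → Bool
  ⌊ P ⌋ = does (em {P})

  ⌊⌋-true : ∀ {P} → P → ⌊ P ⌋ ≡ true
  ⌊⌋-true {P} p with em {P}
  ... | yes _ = refl
  ... | no ¬p = contradiction p ¬p

  ⌊⌋-sound : ∀ {P} → ⌊ P ⌋ ≡ true → P
  ⌊⌋-sound {P} eq with em {P}
  ... | yes p = p

  ⌊⌋-no : ∀ {P} → ¬ P → ⌊ P ⌋ ≡ false
  ⌊⌋-no {P} ¬p with em {P}
  ... | yes p = contradiction p ¬p
  ... | no _  = refl

  ⌊⌋-cong : ∀ {P Q} → P ⇔ Q → ⌊ P ⌋ ≡ ⌊ Q ⌋
  ⌊⌋-cong {P} {Q} P⇔Q with em {P} | em {Q}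
  ... | yes _ | yes _ = refl
  ... | yes p | no ¬q = contradiction (to P⇔Q p) ¬q
  ... | no ¬p | yes q = contradiction (from P⇔Q q) ¬p
  ... | no _  | no _  = refl

  -- The period must exceed 1 to be admissible as the modulus of a numeric predicate.
  record EventuallyPeriodic (U : ℕ → Set) : Set where
    field
      threshold period : ℕ
      1<period         : 1 < period
      periodic         : ∀ k → threshold ≤ k → U k ⇔ U (period + k)

    periodic* : ∀ c k → threshold ≤ k → U k → U (c * period + k)
    periodic* zero    k a≤k u = u
    periodic* (suc c) k a≤k u = subst U (sym (+-assoc period _ k))
      (to (periodic _ (≤-trans a≤k (m≤n+m k _))) (periodic* c k a≤k u))

    -- `j` is one of finitely many representatives. Periods may be added to it only from the
    -- threshold on; below the threshold `k` must be `j` itself.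
    Reduced : ℕ → Set
    Reduced k = ∃₂ λ j c → j < threshold + period × U j × k ≡ c * period + j × (threshold ≤ j ⊎ c ≡ 0)

    reduce : ∀ k → U k → Reduced k
    reduce = <-rec (λ k → U k → Reduced k) go
      where
      go : ∀ k → (∀ {i} → i < k → U i → Reduced i) → U k → Reduced k
      go k rec u with <-≤-connex k (threshold + period)
      ... | inj₁ k<a+p = k , 0 , k<a+p , u , refl , inj₂ refl
      ... | inj₂ a+p≤k =
        let j , c , j< , uⱼ , i≡ , a≤j = rec i<k (from (periodic i a≤i) (subst U k≡ u)) in
        j , suc c , j< , uⱼ , trans k≡ (trans (cong (_+_ period) i≡) (sym (+-assoc period _ j))) ,
        -- If the recursive call removed no period, its representative is `i` itself, which is above
        -- the threshold.
        inj₁ ([ id , (λ c≡0 → subst (threshold ≤_) (trans i≡ (cong (λ d → d * period + j) c≡0)) a≤i) ]′ a≤j)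
        where
        i = k ∸ period
        k≡ : k ≡ period + i
        k≡ = sym (m+[n∸m]≡n (≤-trans (m≤n+m period threshold) a+p≤k))
        a≤i : threshold ≤ i
        a≤i = subst (_≤ i) (m+n∸n≡m threshold period) (∸-monoˡ-≤ period a+p≤k)
        i<k : i < k
        i<k = subst (i <_) (sym k≡) (m<n+m i (<⇒≤ 1<period))

  open EventuallyPeriodic

  -- By pigeonhole, two of the first 2^n + 1 subsets of `Fin n` coincide; as each subset determines
  -- the next, the sequence repeats from there on.
  finite-periodic : ∀ {n} (V : ℕ → Fin n → Set) →
    (∀ i j → (∀ u → V i u ⇔ V j u) → ∀ u → V (suc i) u ⇔ V (suc j) u) →
    ∀ u → EventuallyPeriodic (λ k → V k u)
  finite-periodic {n} V step u = record
    { threshold = a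
    -- The collision only gives `p` ≥ 1; doubling it makes the period exceed 1.
    ; period    = p + p
    ; 1<period  = +-mono-≤ 0<p 0<p
    ; periodic  = λ k a≤k → mk⇔
        (λ h → subst (λ l → V l u) (sym (+-assoc p p k))
                 (to (shift (p + k) (≤-trans a≤k (m≤n+m k p)) u) (to (shift k a≤k u) h)))
        (λ h → from (shift k a≤k u) (from (shift (p + k) (≤-trans a≤k (m≤n+m k p)) u)
                 (subst (λ l → V l u) (+-assoc p p k) h)))
    }
    where
    code : ℕ → Fin (2 ^ n)
    code k = encode (λ u → ⌊ V k u ⌋)

    collision = Finₚ.pigeonhole (n<1+n (2 ^ n)) (code ∘ toℕ)
    a = toℕ (proj₁ collision)
    b = toℕ (proj₁ (proj₂ collision))
    p = b ∸ a
    a<b : a < b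
    a<b = proj₁ (proj₂ (proj₂ collision))
    0<p = m<n⇒0<n∸m a<b

    a~b : ∀ u → V a u ⇔ V b u
    a~b u = mk⇔ (λ h → ⌊⌋-sound (trans (sym same) (⌊⌋-true h)))
                (λ h → ⌊⌋-sound (trans same (⌊⌋-true h)))
      where
      same : ⌊ V a u ⌋ ≡ ⌊ V b u ⌋
      same = begin
        ⌊ V a u ⌋           ≡⟨ decode-encode _ u ⟨
        decode n (code a) u ≡⟨ cong (λ c → decode n c u) (proj₂ (proj₂ (proj₂ collision))) ⟩
        decode n (code b) u ≡⟨ decode-encode _ u ⟩
        ⌊ V b u ⌋           ∎
        where open ≡-Reasoning

    shift₀ : ∀ d u → V (d + a) u ⇔ V (d + b) u
    shift₀ zero    = a~b
    shift₀ (suc d) = step (d + a) (d + b) (shift₀ d)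

    shift : ∀ k → a ≤ k → ∀ u → V k u ⇔ V (p + k) u
    shift k a≤k u = subst₂ (λ i j → V i u ⇔ V j u) (m∸n+n≡m a≤k) eq (shift₀ (k ∸ a) u)
      where
      open ≡-Reasoning
      eq : k ∸ a + b ≡ p + k
      eq = begin
        k ∸ a + b           ≡⟨ cong (_+_ (k ∸ a)) (m∸n+n≡m (<⇒≤ a<b)) ⟨
        k ∸ a + (p + a)     ≡⟨ +-comm (k ∸ a) _ ⟩
        p + a + (k ∸ a)     ≡⟨ +-assoc p a _ ⟩
        p + (a + (k ∸ a))   ≡⟨ cong (_+_ p) (m+[n∸m]≡n a≤k) ⟩
        p + k               ∎

  -- Used for facts that depend on the ontology and the query but not on the data, so that their
  -- classical truth value can be hardwired into the formula.
  guardᶠ : ∀ {n} → Set → FO n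
  guardᶠ P = if ⌊ P ⌋ then ⊤ᶠ else ⊥ᶠ

  -- The first-order form of `Reduced`: the quantified element lies `k` after `x`, a multiple of the
  -- period leads from it to `y`, and that multiple is 0 unless `k` reaches the threshold.
  reducedDistanceᶠ : ∀ {n U} → EventuallyPeriodic U → Fin n → Fin n → ℕ → FO n
  reducedDistanceᶠ {U = U} ep x y k = guardᶠ (U k) ∧ᶠ
    (∃ᶠ (((offsetᶠ k (suc x) zero ∧ᶠ (zero ≤ᶠ suc y)) ∧ᶠ
          congruentᶠ (period ep) (1<period ep) zero (suc y)) ∧ᶠ
         (guardᶠ (threshold ep ≤ k) ∨ᶠ (suc y ≤ᶠ zero))))

  distanceᶠ : ∀ {n U} → EventuallyPeriodic U → Fin n → Fin n → FO n
  distanceᶠ ep x y = ⋁ (threshold ep + period ep) (reducedDistanceᶠ ep x y ∘ toℕ)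

  module ClassicalMeaning (𝒜 : DataInstance) where
    open Domain 𝒜
    open Meaning 𝒜

    ⊩-guard : ∀ {n} (v : Vec Dom n) {P} → (v ⊩ guardᶠ P) ⇔ P
    ⊩-guard v {P} with em {P}
    ... | yes p = mk⇔ (λ _ → p) (λ _ → tt)
    ... | no ¬p = mk⇔ (λ ()) ¬p

    ⊩-distance : ∀ {n} (v : Vec Dom n) {U} (ep : EventuallyPeriodic U) x y →
                 (v ⊩ distanceᶠ ep x y) ⇔ (∃[ k ] pos (lookup v y) ≡ k + pos (lookup v x) × U k)
    ⊩-distance v {U} ep x y = mk⇔ forth back
      where
      a = pos (lookup v x)
      b = pos (lookup v y)
      forth : v ⊩ distanceᶠ ep x y → ∃[ k ] b ≡ k + a × U k
      forth h
        with k , g , z , ((z≡ , z≤y) , c) , alt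
               ← to (⊩-⋁ v (threshold ep + period ep) (reducedDistanceᶠ ep x y ∘ toℕ)) h = [ far , near ]′ alt
        where
        V = z ∷ v
        u = to (⊩-guard v) g
        z≡k+a = to (⊩-offset V (toℕ k) (suc x) zero) z≡
        z≤b = to (⊩-≤ V zero (suc y)) z≤y
        far : V ⊩ guardᶠ (threshold ep ≤ toℕ k) → ∃[ k ] b ≡ k + a × U k
        far g
          with divides e q≡
                 ← to (⊩-congruent V _ (1<period ep) zero (suc y) (b ∸ pos z) (sym (m∸n+n≡m z≤b))) c =
          e * period ep + toℕ k ,
          trans (sym (m∸n+n≡m z≤b)) (trans (cong₂ _+_ q≡ z≡k+a) (sym (+-assoc (e * period ep) _ _))) ,
          periodic* ep e (toℕ k) (to (⊩-guard V) g) u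
        near : V ⊩ suc y ≤ᶠ zero → ∃[ k ] b ≡ k + a × U k
        near y≤z = toℕ k , trans (≤-antisym (to (⊩-≤ V (suc y) zero) y≤z) z≤b) z≡k+a , u
      back : ∃[ k ] b ≡ k + a × U k → v ⊩ distanceᶠ ep x y
      back (k , b≡ , uₖ) with j , c , j< , uⱼ , k≡ , alt ← reduce ep k uₖ =
        from (⊩-⋁ v (threshold ep + period ep) (reducedDistanceᶠ ep x y ∘ toℕ))
          (fromℕ< j< , from (⊩-guard v) (subst U (sym i≡) uⱼ) , z ,
          ((from (⊩-offset V _ (suc x) zero) (trans z≡ (cong (_+ a) (sym i≡))) ,
            from (⊩-≤ V zero (suc y)) z≤b) ,
           from (⊩-congruent V _ (1<period ep) zero (suc y) (c * period ep) b≡c*p+z)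
             (n∣m*n c)) ,
          alternative alt)
        where
        i≡ : toℕ (fromℕ< j<) ≡ j
        i≡ = Finₚ.toℕ-fromℕ< j<
        b≡c*p+j+a : b ≡ c * period ep + (j + a)
        b≡c*p+j+a = trans b≡ (trans (cong (_+ a) k≡) (+-assoc (c * period ep) j a))
        below-y = below (lookup v y) (≤-trans (m≤n+m (j + a) (c * period ep)) (≤-reflexive (sym b≡c*p+j+a)))
        z = proj₁ below-y
        z≡ : pos z ≡ j + a
        z≡ = proj₂ below-y
        b≡c*p+z : b ≡ c * period ep + pos z
        b≡c*p+z = trans b≡c*p+j+a (cong (_+_ (c * period ep)) (sym z≡))
        z≤b : pos z ≤ b
        z≤b = ≤-trans (m≤n+m (pos z) (c * period ep)) (≤-reflexive (sym b≡c*p+z))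
        V = z ∷ v
        alternative : threshold ep ≤ j ⊎ c ≡ 0 → V ⊩ guardᶠ (threshold ep ≤ toℕ (fromℕ< j<)) ∨ᶠ (suc y ≤ᶠ zero)
        alternative (inj₁ a≤j)  = inj₁ (from (⊩-guard V) (subst (threshold ep ≤_) (sym i≡) a≤j))
        alternative (inj₂ refl) = inj₂ (from (⊩-≤ V (suc y) zero) (≤-reflexive (trans b≡c*p+j+a (sym z≡))))

-- Local constraints on truth values and their behaviour under majority.

boolComb-cong : ∀ {n} (φ : BoolComb n) {ρ σ : Fin n → Pred ℤ 0ℓ} {k l} →
                (∀ i → ρ i k ⇔ σ i l) → ⟦ φ ⟧ᵇ ρ k ⇔ ⟦ φ ⟧ᵇ σ l
boolComb-cong (part i) e = e i
boolComb-cong ⊤′       e = mk⇔ id id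
boolComb-cong ⊥′       e = mk⇔ id id
boolComb-cong (¬′ φ)   e = let f = boolComb-cong φ e in mk⇔ (_∘ from f) (_∘ to f)
boolComb-cong (φ ∧′ ψ) e = let f = boolComb-cong φ e ; g = boolComb-cong ψ e in
  mk⇔ (Product.map (to f) (to g)) (Product.map (from f) (from g))
boolComb-cong (φ ∨′ ψ) e = let f = boolComb-cong φ e ; g = boolComb-cong ψ e in
  mk⇔ (Sum.map (to f) (to g)) (Sum.map (from f) (from g))
boolComb-cong (φ →′ ψ) e = let f = boolComb-cong φ e ; g = boolComb-cong ψ e in
  mk⇔ (λ h → to g ∘ h ∘ from f) (λ h → from g ∘ h ∘ to f)
boolComb-cong (φ ↔′ ψ) e = let f = boolComb-cong φ e ; g = boolComb-cong ψ e in
  mk⇔ (Product.map (λ h → to g ∘ h ∘ from f) (λ h → to f ∘ h ∘ from g))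
      (Product.map (λ h → from g ∘ h ∘ to f) (λ h → from f ∘ h ∘ to g))

suffixes : PrefixedAtom → List PrefixedAtom
suffixes ([] ▸ B)         = ([] ▸ B) ∷ []
suffixes ((op ∷ ops) ▸ B) = ((op ∷ ops) ▸ B) ∷ suffixes (ops ▸ B)

self∈suffixes : ∀ p → p ∈ suffixes p
self∈suffixes ([] ▸ B)         = here refl
self∈suffixes ((op ∷ ops) ▸ B) = here refl

tail∈suffixes : ∀ p {op ops B} → (op ∷ ops) ▸ B ∈ suffixes p → ops ▸ B ∈ suffixes p
tail∈suffixes ([] ▸ B)         (here ())
tail∈suffixes ([] ▸ B)         (there ())
tail∈suffixes ((op ∷ ops) ▸ B) (here refl) = there (self∈suffixes (ops ▸ B))
tail∈suffixes ((op ∷ ops) ▸ B) (there p)   = there (tail∈suffixes (ops ▸ B) p)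

-- How the values of op X and of X at n (unprimed) and at n + 1 (primed) are related.
Coherent : TemporalOp → (a b a′ b′ : Bool) → Set
Coherent ○F a b a′ b′ = a ≡ b′
Coherent ○P a b a′ b′ = a′ ≡ b
Coherent □F a b a′ b′ = a ≡ b′ ∧ a′
Coherent □P a b a′ b′ = a′ ≡ b ∧ a
Coherent ◇F a b a′ b′ = a ≡ b′ ∨ a′
Coherent ◇P a b a′ b′ = a′ ≡ b ∨ a

-- The values of □ and ◇ formulas change at most once in time;
-- the gauge orients that change from false to true.
gauge : TemporalOp → Bool → Bool
gauge ○F a = false
gauge ○P a = false
gauge □F a = a
gauge □P a = not a
gauge ◇F a = not a
gauge ◇P a = a

∧-≤ : ∀ b a → b ∧ a Bool.≤ a
∧-≤ true  a     = b≤b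
∧-≤ false true  = f≤t
∧-≤ false false = b≤b

≤-∨ : ∀ b a → a Bool.≤ b ∨ a
≤-∨ false a     = b≤b
≤-∨ true  true  = b≤b
≤-∨ true  false = f≤t

not-antitone : ∀ {a b} → a Bool.≤ b → not b Bool.≤ not a
not-antitone f≤t = f≤t
not-antitone b≤b = b≤b

gauge-rises : ∀ op {a b a′ b′} → Coherent op a b a′ b′ → gauge op a Bool.≤ gauge op a′
gauge-rises ○F _    = b≤b
gauge-rises ○P _    = b≤b
gauge-rises □F refl = ∧-≤ _ _
gauge-rises □P refl = not-antitone (∧-≤ _ _)
gauge-rises ◇F refl = not-antitone (≤-∨ _ _)
gauge-rises ◇P refl = ≤-∨ _ _

-- With `g` fixed, unfolding only says that `g` implies `b`. If `g` is true, two true arguments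
-- already settle the majority.
□-maj : ∀ g b₁ b₂ b₃ → g ≡ b₁ ∧ g → g ≡ b₂ ∧ g → maj g g g ≡ maj b₁ b₂ b₃ ∧ maj g g g
□-maj false b₁   b₂   b₃ _ _ = sym (∧-zeroʳ (maj b₁ b₂ b₃))
□-maj true  true true b₃ _ _ = refl

◇-maj : ∀ g b₁ b₂ b₃ → g ≡ b₁ ∨ g → g ≡ b₂ ∨ g → maj g g g ≡ maj b₁ b₂ b₃ ∨ maj g g g
◇-maj true  b₁    b₂    b₃ _ _ = sym (∨-zeroʳ (maj b₁ b₂ b₃))
◇-maj false false false b₃ _ _ = refl

not-swap : ∀ {a g} → not a ≡ g → a ≡ not g
not-swap {a} refl = sym (not-involutive a)

-- Unfolding □ and ◇ is a ternary constraint, hence not preserved by majority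
-- unless the values of the □ or ◇ formula itself agree everywhere.
maj-coherent : ∀ op {g a₁ a₂ a₃ b₁ b₂ b₃ a₁′ a₂′ a₃′ b₁′ b₂′ b₃′} →
  gauge op a₁ ≡ g → gauge op a₂ ≡ g → gauge op a₃ ≡ g →
  gauge op a₁′ ≡ g → gauge op a₂′ ≡ g → gauge op a₃′ ≡ g →
  Coherent op a₁ b₁ a₁′ b₁′ → Coherent op a₂ b₂ a₂′ b₂′ → Coherent op a₃ b₃ a₃′ b₃′ →
  Coherent op (maj a₁ a₂ a₃) (maj b₁ b₂ b₃) (maj a₁′ a₂′ a₃′) (maj b₁′ b₂′ b₃′)
maj-coherent ○F _ _ _ _ _ _ refl refl refl = refl
maj-coherent ○P _ _ _ _ _ _ refl refl refl = refl
maj-coherent □F refl refl refl refl refl refl c₁ c₂ _ = □-maj _ _ _ _ c₁ c₂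
maj-coherent ◇P refl refl refl refl refl refl c₁ c₂ _ = ◇-maj _ _ _ _ c₁ c₂
maj-coherent □P e₁ e₂ e₃ e₁′ e₂′ e₃′ c₁ c₂ _
  with refl ← not-swap e₁ | refl ← not-swap e₂ | refl ← not-swap e₃
     | refl ← not-swap e₁′ | refl ← not-swap e₂′ | refl ← not-swap e₃′ = □-maj _ _ _ _ c₁ c₂
maj-coherent ◇F e₁ e₂ e₃ e₁′ e₂′ e₃′ c₁ c₂ _
  with refl ← not-swap e₁ | refl ← not-swap e₂ | refl ← not-swap e₃
     | refl ← not-swap e₁′ | refl ← not-swap e₂′ | refl ← not-swap e₃′ = ◇-maj _ _ _ _ c₁ c₂

trues : List Bool → ℕ
trues []           = 0
trues (true  ∷ bs) = suc (trues bs)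
trues (false ∷ bs) = trues bs

trues≤length : ∀ bs → trues bs ≤ length bs
trues≤length []           = z≤n
trues≤length (true  ∷ bs) = s≤s (trues≤length bs)
trues≤length (false ∷ bs) = m≤n⇒m≤1+n (trues≤length bs)

-- A pointwise increase never loses a true, so the number of trues is a potential that grows at
-- every change.
stall-or-rise : ∀ {X : Set} (xs : List X) {f g : X → Bool} → (∀ x → x ∈ xs → f x Bool.≤ g x) →
                map f xs ≡ map g xs ⊎ trues (map f xs) < trues (map g xs)
stall-or-rise []       f≤g = inj₁ refl
stall-or-rise (x ∷ xs) {f} {g} f≤g
  with f x | g x | f≤g x (here refl) | stall-or-rise xs (λ y y∈ → f≤g y (there y∈))
... | false | true  | f≤t | inj₁ eq = inj₂ (s≤s (≤-reflexive (cong trues eq)))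
... | false | true  | f≤t | inj₂ lt = inj₂ (m≤n⇒m≤1+n lt)
... | b     | .b    | b≤b | inj₁ eq = inj₁ (cong (b ∷_) eq)
... | true  | .true | b≤b | inj₂ lt = inj₂ (s≤s lt)
... | false | .false | b≤b | inj₂ lt = inj₂ lt

map-≡⇒≗ : ∀ {X Y : Set} {f g : X → Y} xs → map f xs ≡ map g xs → ∀ {x} → x ∈ xs → f x ≡ g x
map-≡⇒≗ (x ∷ xs) eq (here refl) = proj₁ (∷-injective eq)
map-≡⇒≗ (x ∷ xs) eq (there x∈)  = map-≡⇒≗ xs (proj₂ (∷-injective eq)) x∈

-- The finite graph of states.

module States (em : ExcludedMiddle 0ℓ) (𝒪 : Ontology) (A : Atom) where
  open KromFormula
  open Classical em

  -- The query is added because it need not occur in the ontology, and an atom outside the closure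
  -- could never be refuted.
  relevant : List PrefixedAtom
  relevant = ([] ▸ A) ∷ concatMap (Vec.toList ∘ parts) 𝒪

  abstract

    closure : List PrefixedAtom
    closure = concatMap suffixes relevant

    query∈closure : ([] ▸ A) ∈ closure
    query∈closure = here refl

    part∈closure : ∀ {α} → α ∈ 𝒪 → ∀ i → lookup (parts α) i ∈ closure
    part∈closure {α} α∈𝒪 i = ∈-concatMap⁺ suffixes {xs = relevant} (there
      (lose (∈-concatMap⁺ (Vec.toList ∘ parts) (lose α∈𝒪 (∈-toList⁺ (∈-lookup i (parts α)))))
            (self∈suffixes _)))

    tail∈closure : ∀ {op ops B} → (op ∷ ops) ▸ B ∈ closure → ops ▸ B ∈ closure
    tail∈closure p∈ = ∈-concatMap⁺ suffixes {xs = relevant}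
      (Any.map (λ {q} → tail∈suffixes q) (∈-concatMap⁻ suffixes {xs = relevant} p∈))

  size : ℕ
  size = length closure

  State : Set
  State = Fin (2 ^ size)

  -- Formulas outside the closure are given the value true.
  val : State → PrefixedAtom → Bool
  val s p with em {p ∈ closure}
  ... | yes p∈ = decode size s (index p∈)
  ... | no _   = true

  val-∉ : ∀ {p} s → ¬ (p ∈ closure) → val s p ≡ true
  val-∉ {p} s p∉ with em {p ∈ closure}
  ... | yes p∈ = contradiction p∈ p∉
  ... | no _   = refl

  state : (PrefixedAtom → Bool) → State
  state f = encode (f ∘ List.lookup closure)

  val-state : ∀ {p} f → p ∈ closure → val (state f) p ≡ f p
  val-state {p} f p∈ with em {p ∈ closure}
  ... | yes p∈′ = trans (decode-encode (f ∘ List.lookup closure) (index p∈′)) (cong f (sym (lookup-index p∈′)))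
  ... | no p∉   = contradiction p∈ p∉

  majority : State → State → State → State
  majority a b c = encode (λ i → maj (decode size a i) (decode size b i) (decode size c i))

  val-majority : ∀ a b c p → val (majority a b c) p ≡ maj (val a p) (val b p) (val c p)
  val-majority a b c p with em {p ∈ closure}
  ... | yes p∈ = decode-encode _ (index p∈)
  ... | no _   = refl

  majority-idem : ∀ a → majority a a a ≡ a
  majority-idem a = trans (encode-cong {size} (λ i → maj-idem (decode size a i))) (encode-decode {size} a)

  -- The valuation is constant in time, so the instant 0 at which the combination is read is
  -- arbitrary.
  Valid : State → Set
  Valid s = ∀ α → α ∈ 𝒪 → ⟦ shape α ⟧ᵇ (λ i _ → val s (lookup (parts α) i) ≡ true) 0ℤ

  Edge : Rel State 0ℓ
  Edge s s′ = ∀ op ops B → (op ∷ ops) ▸ B ∈ closure →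
    Coherent op (val s ((op ∷ ops) ▸ B)) (val s (ops ▸ B)) (val s′ ((op ∷ ops) ▸ B)) (val s′ (ops ▸ B))

  gaugeₚ : PrefixedAtom → Bool → Bool
  gaugeₚ ([] ▸ B)         a = false
  gaugeₚ ((op ∷ ops) ▸ B) a = gauge op a

  gauges : State → List Bool
  gauges s = map (λ p → gaugeₚ p (val s p)) closure

  trues-gauges≤size : ∀ s → trues (gauges s) ≤ size
  trues-gauges≤size s = ≤-trans (trues≤length (gauges s)) (≤-reflexive (length-map _ closure))

  edge-stalls-or-rises : ∀ {s s′} → Edge s s′ → gauges s ≡ gauges s′ ⊎ trues (gauges s) < trues (gauges s′)
  edge-stalls-or-rises {s} {s′} e = stall-or-rise closure rises
    where
    rises : ∀ p → p ∈ closure → gaugeₚ p (val s p) Bool.≤ gaugeₚ p (val s′ p)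
    rises ([] ▸ B)         _  = b≤b
    rises ((op ∷ ops) ▸ B) p∈ = gauge-rises op (e op ops B p∈)

  Level : List Bool → State → Set
  Level β s = Valid s × gauges s ≡ β

  -- Here the Krom restriction enters: an axiom has at most two parts, on which the majority agrees
  -- with one of the three states and inherits its validity. Gauges persist because each value of
  -- the majority is a value of one of the three.
  majority-level : ∀ {β a b c} → Level β a → Level β b → Level β c → Level β (majority a b c)
  majority-level {β} {a} {b} {c} (va , refl) (vb , gb) (vc , gc) = valid , level
    where
    m = majority a b c
    valid : Valid m
    valid α α∈
      with maj-overlap (arity≤2 α) (λ i → val a (lookup (parts α) i)) (λ i → val b (lookup (parts α) i))
                                   (λ i → val c (lookup (parts α) i))
    ... | inj₁ e        = to (boolComb-cong (shape α) λ i → let e′ = trans (e i) (sym (val-majority a b c _)) in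
                              mk⇔ (trans (sym e′)) (trans e′)) (va α α∈)
    ... | inj₂ (inj₁ e) = to (boolComb-cong (shape α) λ i → let e′ = trans (e i) (sym (val-majority a b c _)) in
                              mk⇔ (trans (sym e′)) (trans e′)) (vb α α∈)
    ... | inj₂ (inj₂ e) = to (boolComb-cong (shape α) λ i → let e′ = trans (e i) (sym (val-majority a b c _)) in
                              mk⇔ (trans (sym e′)) (trans e′)) (vc α α∈)
    level : gauges m ≡ gauges a
    level = map-cong-local (All.tabulate at)
      where
      at : ∀ {p} → p ∈ closure → gaugeₚ p (val m p) ≡ gaugeₚ p (val a p)
      at {p} p∈ rewrite val-majority a b c p with maj-agrees (val a p) (val b p) (val c p)
      ... | inj₁ (e , _)        = cong (gaugeₚ p) (sym e)
      ... | inj₂ (inj₁ (e , _)) = cong (gaugeₚ p) (sym e)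
      ... | inj₂ (inj₂ (e , _)) = trans (cong (gaugeₚ p) (sym e)) (map-≡⇒≗ closure gb p∈)

  majority-edge : ∀ {β a b c a′ b′ c′} → Level β a → Level β b → Level β c →
                  Level β a′ → Level β b′ → Level β c′ →
                  Edge a a′ → Edge b b′ → Edge c c′ → Edge (majority a b c) (majority a′ b′ c′)
  majority-edge {β} {a} {b} {c} {a′} {b′} {c′}
                (_ , refl) (_ , gb) (_ , gc) (_ , ga′) (_ , gb′) (_ , gc′) ea eb ec op ops B p∈
    rewrite val-majority a b c ((op ∷ ops) ▸ B) | val-majority a b c (ops ▸ B)
          | val-majority a′ b′ c′ ((op ∷ ops) ▸ B) | val-majority a′ b′ c′ (ops ▸ B) =
    maj-coherent op refl (at gb) (at gc) (at ga′) (at gb′) (at gc′)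
      (ea op ops B p∈) (eb op ops B p∈) (ec op ops B p∈)
    where
    at : ∀ {s} → gauges s ≡ gauges a → gauge op (val s ((op ∷ ops) ▸ B)) ≡ gauge op (val a ((op ∷ ops) ▸ B))
    at eq = map-≡⇒≗ closure eq p∈

  open Walks Edge public

  module Fitting (D : ℕ → Atom → Set) where

    Fits : ℕ → State → Set
    Fits i s = ∀ B → D i B → val s ([] ▸ B) ≡ true

    majority-fits : ∀ {i a b c} → TwoOf (Fits i a) (Fits i b) (Fits i c) → Fits i (majority a b c)
    majority-fits {i} {a} {b} {c} two B d = trans (val-majority a b c _) (maj-true (at two))
      where
      at : TwoOf (Fits i a) (Fits i b) (Fits i c) →
           TwoOf (val a ([] ▸ B) ≡ true) (val b ([] ▸ B) ≡ true) (val c ([] ▸ B) ≡ true)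
      at (inj₁ (f , g))        = inj₁ (f B d , g B d)
      at (inj₂ (inj₁ (f , g))) = inj₂ (inj₁ (f B d , g B d))
      at (inj₂ (inj₂ (f , g))) = inj₂ (inj₂ (f B d , g B d))

    Passage : ℕ → State → ℕ → State → Set
    Passage = Walk (λ i u → Valid u × Fits i u)

    LevelPassage : ℕ → State → ℕ → State → Set
    LevelPassage x s = Walk (λ i u → Level (gauges s) u × Fits i u) x s

    -- The left side quantifies over a run, the right side over instants and finitely many states;
    -- this exchange makes passages within a level first-order definable.
    levelPassage⇔linked : ∀ {x s y t} → LevelPassage x s y t ⇔
      (x ≤ y × (∀ z w → x ≤ z → z ≤ w → w ≤ y → Linked (Level (gauges s)) Fits x s y t z w))
    levelPassage⇔linked {s = s} = mk⇔
      (λ w → proj₁ w , walk⇒linked w)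
      (λ (x≤y , link) → linked⇒walk x≤y link)
      where open Helly (Level (gauges s)) Fits majority majority-idem majority-level majority-edge majority-fits

    -- `k` bounds the number of segment changes, so that recursion on `k` yields a formula of fixed
    -- depth, whatever the length of the passage.
    Stages : ℕ → ℕ → State → ℕ → State → Set
    Stages zero    x s y t = LevelPassage x s y t
    Stages (suc k) x s y t = LevelPassage x s y t ⊎
      (∃₂ λ u v → Edge u v × ∃[ z ] LevelPassage x s z u × Stages k (suc z) v y t)

    level⇒stages : ∀ k {x s y t} → LevelPassage x s y t → Stages k x s y t
    level⇒stages zero    w = w
    level⇒stages (suc k) w = inj₁ w

    level⇒passage : ∀ {x s y t} → LevelPassage x s y t → Passage x s y t
    level⇒passage = map-walk λ _ ((valid , _) , fits) → valid , fits

    stages⇒passage : ∀ k {x s y t} → Stages k x s y t → Passage x s y t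
    stages⇒passage zero    w        = level⇒passage w
    stages⇒passage (suc k) (inj₁ w) = level⇒passage w
    stages⇒passage (suc k) {x} {s} {y} {t} (inj₂ (u , v , e , z , w , rest)) =
      walk-trans (level⇒passage w) (cons (last-holds w) e (stages⇒passage k rest))
      where
      last-holds : LevelPassage x s z u → Valid u × Fits z u
      last-holds (x≤z , r , _ , refl , R) = let (valid , _) , fits = holds R z x≤z ≤-refl in valid , fits

    cons-level : ∀ {x s u y t} → Valid s × Fits x s → Edge s u → gauges s ≡ gauges u →
                 LevelPassage (suc x) u y t → LevelPassage x s y t
    cons-level {x} {s} {u} {y} {t} (valid , fits) e s~u w =
      cons ((valid , refl) , fits) e
        (subst (λ β → Walk (λ i v → Level β v × Fits i v) (suc x) u y t) (sym s~u) w)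

    cons-stages : ∀ k {x s u y t} → Valid s × Fits x s → Edge s u → gauges s ≡ gauges u →
                  Stages k (suc x) u y t → Stages k x s y t
    cons-stages zero    p e s~u w        = cons-level p e s~u w
    cons-stages (suc k) p e s~u (inj₁ w) = inj₁ (cons-level p e s~u w)
    cons-stages (suc k) p e s~u (inj₂ (v , v′ , e′ , z , w , rest)) =
      inj₂ (v , v′ , e′ , z , cons-level p e s~u w , rest)

    -- The bound says that `k` is at least the number of gauges still false, hence of rises still
    -- possible. With `k` = 0 a rise would make more gauges true than there are.
    passage⇒stages-within : ∀ d k {x s t} → size ≤ trues (gauges s) + k → Passage x s (d + x) t →
                            Stages k x s (d + x) t
    passage⇒stages-within zero k _ w with refl ← stationary w =
      let valid , fits = head w in level⇒stages k (walk-refl ((valid , refl) , fits))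
    passage⇒stages-within (suc d) k {x} {s} {t} bound w
      with u , e , w′ ← uncons (s≤s (m≤n+m x d)) w
      with edge-stalls-or-rises e | subst (λ y → Passage (suc x) u y t) (sym (+-suc d x)) w′
    ... | inj₁ s~u | w″ = cons-stages k (head w) e s~u
      (subst (λ y → Stages k (suc x) u y t) (+-suc d x)
        (passage⇒stages-within d k (subst (λ β → size ≤ trues β + k) s~u bound) w″))
    passage⇒stages-within (suc d) zero {x} {s} {t} bound w | inj₂ s<u | w″ =
      contradiction (≤-trans (s≤s (≤-trans bound (≤-reflexive (+-identityʳ _)))) s<u)
                    (≤⇒≯ (trues-gauges≤size u))
    passage⇒stages-within (suc d) (suc k) {x} {s} {t} bound w | inj₂ s<u | w″ =
      let valid , fits = head w in
      inj₂ (s , u , e , x , walk-refl ((valid , refl) , fits) ,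
        subst (λ y → Stages k (suc x) u y t) (+-suc d x)
          (passage⇒stages-within d k
            (≤-trans bound (≤-trans (≤-reflexive (+-suc _ k)) (+-monoˡ-≤ k s<u))) w″))

    passage⇔stages : ∀ {x s y t} → Passage x s y t ⇔ Stages size x s y t
    passage⇔stages {x} {s} {y} {t} = mk⇔
      (λ w → subst (λ y → Stages size x s y t) (m∸n+n≡m (proj₁ w))
        (passage⇒stages-within (y ∸ x) size (m≤n+m size _)
          (subst (λ y → Passage x s y t) (sym (m∸n+n≡m (proj₁ w))) w)))
      (stages⇒passage size)

-- First-order definition of passages.

module Formulas (em : ExcludedMiddle 0ℓ) (𝒪 : Ontology) (A : Atom) where
  open Classical em
  open States em 𝒪 A

  ⋁ₛ : ∀ {n} → (State → FO n) → FO n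
  ⋁ₛ = ⋁ (2 ^ size)

  -- The target is fixed and the source varies: `Steps` peels off the first edge, so the sources at
  -- one length determine those at the next.
  steps-periodic : ∀ β s t → EventuallyPeriodic (λ k → Steps (Level β) k s t)
  steps-periodic β s t = finite-periodic (λ k u → Steps (Level β) k u t)
    (λ i j i~j u → mk⇔
      (λ (l , v , e , σ) → l , v , e , to (i~j v) σ)
      (λ (l , v , e , σ) → l , v , e , from (i~j v) σ))
    s

  walkᶠ : ∀ {n} → List Bool → State → State → Fin n → Fin n → FO n
  walkᶠ β s t x y = distanceᶠ (steps-periodic β s t) x y

  -- A finite conjunction over the closure suffices, since any other atom is true in every state and
  -- cannot conflict with the data.
  fitsOnᶠ : ∀ {n} → List PrefixedAtom → State → Fin n → FO n
  fitsOnᶠ []                       s x = ⊤ᶠ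
  fitsOnᶠ (([] ▸ B) ∷ ps)          s x = (if val s ([] ▸ B) then ⊤ᶠ else (¬ᶠ (atomᶠ B x))) ∧ᶠ fitsOnᶠ ps s x
  fitsOnᶠ (((op ∷ ops) ▸ B) ∷ ps)  s x = fitsOnᶠ ps s x

  fitsᶠ : ∀ {n} → State → Fin n → FO n
  fitsᶠ = fitsOnᶠ closure

  linkᶠ : ∀ {n} → State → State → Fin n → Fin n → Fin n → Fin n → State → State → FO n
  linkᶠ s t x y z w u v = fitsᶠ u z ∧ᶠ (fitsᶠ v w ∧ᶠ
    (walkᶠ (gauges s) s u x z ∧ᶠ (walkᶠ (gauges s) u v z w ∧ᶠ walkᶠ (gauges s) v t w y)))

  linkedᶠ : ∀ {n} → State → State → Fin n → Fin n → FO n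
  linkedᶠ s t x y = ∀ᶠ ∀ᶠ
    ((suc (suc x) ≤ᶠ suc zero) →ᶠ ((suc zero ≤ᶠ zero) →ᶠ ((zero ≤ᶠ suc (suc y)) →ᶠ
      ⋁ₛ (λ u → ⋁ₛ (linkᶠ s t (suc (suc x)) (suc (suc y)) (suc zero) zero u)))))

  levelᶠ : ∀ {n} → State → State → Fin n → Fin n → FO n
  levelᶠ s t x y = (x ≤ᶠ y) ∧ᶠ linkedᶠ s t x y

  mutual

    stagesᶠ : ∀ {n} → ℕ → State → State → Fin n → Fin n → FO n
    stagesᶠ zero    s t x y = levelᶠ s t x y
    stagesᶠ (suc k) s t x y = levelᶠ s t x y ∨ᶠ ⋁ₛ (λ u → ⋁ₛ (switchᶠ k s t x y u))

    switchᶠ : ∀ {n} → ℕ → State → State → Fin n → Fin n → State → State → FO n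
    switchᶠ k s t x y u v = guardᶠ (Edge u v) ∧ᶠ (∃ᶠ ∃ᶠ
      (levelᶠ s u (suc (suc x)) (suc zero) ∧ᶠ
        (successorᶠ (suc zero) zero ∧ᶠ stagesᶠ k v t zero (suc (suc y)))))

  passageᶠ : ∀ {n} → State → State → Fin n → Fin n → FO n
  passageᶠ = stagesᶠ size

  module FormulaMeaning (𝒜 : DataInstance) where
    open Domain 𝒜
    open Meaning 𝒜
    open ClassicalMeaning 𝒜
    open Fitting Data

    ⊩-⋁⋁ : ∀ {n} (v : Vec Dom n) (φ : State → State → FO n) → (v ⊩ ⋁ₛ (λ s → ⋁ₛ (φ s))) ⇔ (∃₂ λ s t → v ⊩ φ s t)
    ⊩-⋁⋁ v φ = mk⇔
      (λ h → Product.map₂ (to (⊩-⋁ v (2 ^ size) (φ _))) (to (⊩-⋁ v (2 ^ size) (λ s → ⋁ₛ (φ s))) h))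
      (λ (s , h) → from (⊩-⋁ v (2 ^ size) (λ s → ⋁ₛ (φ s))) (s , from (⊩-⋁ v (2 ^ size) (φ s)) h))

    ⊩-walk : ∀ {n} (v : Vec Dom n) β s t x y →
             (v ⊩ walkᶠ β s t x y) ⇔ Walk (λ _ → Level β) (pos (lookup v x)) s (pos (lookup v y)) t
    ⊩-walk v β s t x y = mk⇔
      (λ h → let k , y≡ , σ = to (⊩-distance v (steps-periodic β s t) x y) h in
        subst (λ b → Walk (λ _ → Level β) a s b t) (sym y≡) (steps⇒walk k σ))
      (λ w → let y≡ = sym (m∸n+n≡m (proj₁ w)) in
        from (⊩-distance v (steps-periodic β s t) x y)
          (_ , y≡ , walk⇒steps _ (subst (λ b → Walk (λ _ → Level β) a s b t) y≡ w)))
      where a = pos (lookup v x)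

    ⊩-fitsOn : ∀ {n} (v : Vec Dom n) ps s x → (v ⊩ fitsOnᶠ ps s x) ⇔
               (∀ B → ([] ▸ B) ∈ ps → Data (pos (lookup v x)) B → val s ([] ▸ B) ≡ true)
    ⊩-fitsOn v []                      s x = mk⇔ (λ _ B ()) (λ _ → tt)
    ⊩-fitsOn v (((op ∷ ops) ▸ C) ∷ ps) s x = mk⇔
      (λ { h B (there p) → to (⊩-fitsOn v ps s x) h B p })
      (λ h → from (⊩-fitsOn v ps s x) λ B p → h B (there p))
    ⊩-fitsOn v (([] ▸ C) ∷ ps)         s x with val s ([] ▸ C) in eq
    ... | true  = mk⇔
      (λ { (_ , h) B (here refl) _ → eq
         ; (_ , h) B (there p)     → to (⊩-fitsOn v ps s x) h B p })
      (λ h → tt , from (⊩-fitsOn v ps s x) λ B p → h B (there p))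
    ... | false = mk⇔
      (λ { (¬d , _) B (here refl) d → contradiction (from (data-pos (lookup v x) C) d) ¬d
         ; (_ , h)  B (there p)     → to (⊩-fitsOn v ps s x) h B p })
      (λ h → (λ d → contradiction (trans (sym eq) (h C (here refl) (to (data-pos (lookup v x) C) d))) λ ()) ,
             from (⊩-fitsOn v ps s x) λ B p → h B (there p))

    ⊩-fits : ∀ {n} (v : Vec Dom n) s x → (v ⊩ fitsᶠ s x) ⇔ Fits (pos (lookup v x)) s
    ⊩-fits v s x = mk⇔ forth (λ fits → from (⊩-fitsOn v closure s x) λ B _ → fits B)
      where
      forth : v ⊩ fitsᶠ s x → Fits (pos (lookup v x)) s
      forth h B d = [ (λ B∈ → to (⊩-fitsOn v closure s x) h B B∈ d) , val-∉ s ]′ (Dec.toSum em)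

    ⊩-link : ∀ {n} (v : Vec Dom n) s t x y z w → (v ⊩ ⋁ₛ (λ u → ⋁ₛ (linkᶠ s t x y z w u))) ⇔
             Linked (Level (gauges s)) Fits (pos (lookup v x)) s (pos (lookup v y)) t
                    (pos (lookup v z)) (pos (lookup v w))
    ⊩-link v s t x y z w = mk⇔ (forth ∘ to ⊩-⋁⋁ₗ) (from ⊩-⋁⋁ₗ ∘ back)
      where
      ⊩-⋁⋁ₗ = ⊩-⋁⋁ v (linkᶠ s t x y z w)
      β = gauges s
      L = Linked (Level β) Fits (pos (lookup v x)) s (pos (lookup v y)) t (pos (lookup v z)) (pos (lookup v w))
      forth : (∃₂ λ a b → v ⊩ linkᶠ s t x y z w a b) → L
      forth (a , b , f , g , w₁ , w₂ , w₃) =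
        a , b , to (⊩-fits v a z) f , to (⊩-fits v b w) g ,
        to (⊩-walk v β s a x z) w₁ , to (⊩-walk v β a b z w) w₂ , to (⊩-walk v β b t w y) w₃
      back : L → ∃₂ λ a b → v ⊩ linkᶠ s t x y z w a b
      back (a , b , f , g , w₁ , w₂ , w₃) =
        a , b , from (⊩-fits v a z) f , from (⊩-fits v b w) g ,
        from (⊩-walk v β s a x z) w₁ , from (⊩-walk v β a b z w) w₂ , from (⊩-walk v β b t w y) w₃

    ⊩-level : ∀ {n} (v : Vec Dom n) s t x y →
              (v ⊩ levelᶠ s t x y) ⇔ LevelPassage (pos (lookup v x)) s (pos (lookup v y)) t
    ⊩-level v s t x y = mk⇔
      (λ (x≤y , h) → from levelPassage⇔linked (to (⊩-≤ v x y) x≤y , forth h))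
      (λ w → let x≤y , link = to levelPassage⇔linked w in
        from (⊩-≤ v x y) x≤y , λ d e x≤d d≤e e≤y →
          let V = e ∷ d ∷ v in
          from (⊩-link V s t (suc (suc x)) (suc (suc y)) (suc zero) zero)
            (link (pos d) (pos e) (to (⊩-≤ V (suc (suc x)) (suc zero)) x≤d)
              (to (⊩-≤ V (suc zero) zero) d≤e) (to (⊩-≤ V zero (suc (suc y))) e≤y)))
      where
      a = pos (lookup v x)
      b = pos (lookup v y)
      forth : v ⊩ linkedᶠ s t x y → ∀ i j → a ≤ i → i ≤ j → j ≤ b → Linked (Level (gauges s)) Fits a s b t i j
      forth h i j a≤i i≤j j≤b with below (lookup v y) (≤-trans i≤j j≤b) | below (lookup v y) j≤b
      ... | d , refl | e , refl =
        let V = e ∷ d ∷ v in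
        to (⊩-link V s t (suc (suc x)) (suc (suc y)) (suc zero) zero)
          (h d e (from (⊩-≤ V (suc (suc x)) (suc zero)) a≤i)
                 (from (⊩-≤ V (suc zero) zero) i≤j) (from (⊩-≤ V zero (suc (suc y))) j≤b))

    ⊩-stages : ∀ {n} (v : Vec Dom n) k s t x y →
               (v ⊩ stagesᶠ k s t x y) ⇔ Stages k (pos (lookup v x)) s (pos (lookup v y)) t
    ⊩-stages v zero    s t x y = ⊩-level v s t x y
    ⊩-stages v (suc k) s t x y = mk⇔ forth back
      where
      a = pos (lookup v x)
      b = pos (lookup v y)
      ⊩-switches = ⊩-⋁⋁ v (switchᶠ k s t x y)
      switch : (∃₂ λ u u′ → v ⊩ switchᶠ k s t x y u u′) → Stages (suc k) a s b t
      switch (u , u′ , g , d , e , l , d⋖e , rest) =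
        inj₂ (u , u′ , to (⊩-guard v) g , pos d ,
          to (⊩-level (e ∷ d ∷ v) s u (suc (suc x)) (suc zero)) l ,
          subst (λ z → Stages k z u′ b t) (to (⊩-successor (e ∷ d ∷ v) (suc zero) zero) d⋖e)
            (to (⊩-stages (e ∷ d ∷ v) k u′ t zero (suc (suc y))) rest))
      unswitch : ∀ {u u′ z} → Edge u u′ → LevelPassage a s z u → Stages k (suc z) u′ b t →
                 (∃[ d ] pos d ≡ z) → (∃[ e ] pos e ≡ suc z) → v ⊩ switchᶠ k s t x y u u′
      unswitch {u} {u′} edge w rest (d , refl) (e , e≡1+d) =
        from (⊩-guard v) edge , d , e ,
        from (⊩-level (e ∷ d ∷ v) s u (suc (suc x)) (suc zero)) w ,
        from (⊩-successor (e ∷ d ∷ v) (suc zero) zero) e≡1+d ,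
        from (⊩-stages (e ∷ d ∷ v) k u′ t zero (suc (suc y)))
          (subst (λ z → Stages k z u′ b t) (sym e≡1+d) rest)
      forth : v ⊩ stagesᶠ (suc k) s t x y → Stages (suc k) a s b t
      forth (inj₁ h) = inj₁ (to (⊩-level v s t x y) h)
      forth (inj₂ h) = switch (to ⊩-switches h)
      back : Stages (suc k) a s b t → v ⊩ stagesᶠ (suc k) s t x y
      back (inj₁ w) = inj₁ (from (⊩-level v s t x y) w)
      back (inj₂ (u , u′ , edge , z , w , rest)) = inj₂ (from ⊩-switches (u , u′ ,
        unswitch edge w rest (below (lookup v y) (<⇒≤ z<b)) (below (lookup v y) z<b)))
        where
        z<b : z < b
        z<b = proj₁ (stages⇒passage k rest)

    ⊩-passage : ∀ {n} (v : Vec Dom n) s t x y →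
                (v ⊩ passageᶠ s t x y) ⇔ Passage (pos (lookup v x)) s (pos (lookup v y)) t
    ⊩-passage v s t x y = mk⇔ (from passage⇔stages ∘ to (⊩-stages v size s t x y))
                              (from (⊩-stages v size s t x y) ∘ to passage⇔stages)

-- The unbounded operators in either direction of time.

data Side : Set where
  future past : Side

-- Direction and quantifier become parameters, so that one argument serves all four of □F, □P, ◇F
-- and ◇P.
unbounded : Side → Bool → TemporalOp
unbounded future true  = □F
unbounded future false = ◇F
unbounded past   true  = □P
unbounded past   false = ◇P

signed : Side → ℕ → ℤ
signed future j = + j
signed past   j = ℤ.- (+ j)

move : Side → ℤ → ℕ → ℤ
move d n j = n ℤ.+ signed d j

signed-+ : ∀ d i j → signed d (i + j) ≡ signed d i ℤ.+ signed d j
signed-+ future i j = refl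
signed-+ past   i j = ℤₚ.neg-distrib-+ (+ i) (+ j)

move-0 : ∀ d n → move d n 0 ≡ n
move-0 future n = ℤₚ.+-identityʳ n
move-0 past   n = ℤₚ.+-identityʳ n

move-+ : ∀ d n i j → move d (move d n i) j ≡ move d n (i + j)
move-+ d n i j = trans (ℤₚ.+-assoc n _ _) (cong (ℤ._+_ n) (sym (signed-+ d i j)))

Beyond : Side → ℤ → ℤ → Set
Beyond future n k = n ℤ.< k
Beyond past   n k = k ℤ.< n

move-beyond : ∀ d n j → Beyond d n (move d n (suc j))
move-beyond future n j = subst (ℤ._< n ℤ.+ + suc j) (ℤₚ.+-identityʳ n) (ℤₚ.+-monoʳ-< n (ℤ.+<+ (s≤s z≤n)))
move-beyond past   n j = subst (n ℤ.- + suc j ℤ.<_) (ℤₚ.+-identityʳ n) (ℤₚ.+-monoʳ-< n ℤ.-<+)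

<⇒+suc : ∀ {n k} → n ℤ.< k → ∃[ j ] k ≡ n ℤ.+ + suc j
<⇒+suc {n} {k} n<k = ∣ k ℤ.- (1ℤ ℤ.+ n) ∣ , trans (k≡ n k) (cong (λ j → n ℤ.+ (1ℤ ℤ.+ j))
  (sym (ℤₚ.0≤i⇒+∣i∣≡i (ℤₚ.i≤j⇒0≤j-i (ℤₚ.i<j⇒suc[i]≤j n<k)))))
  where
  k≡ : ∀ n k → k ≡ n ℤ.+ (1ℤ ℤ.+ (k ℤ.- (1ℤ ℤ.+ n)))
  k≡ = solve-∀

beyond⇒move : ∀ d {n k} → Beyond d n k → ∃[ j ] k ≡ move d n (suc j)
beyond⇒move future n<k = <⇒+suc n<k
beyond⇒move past {n} {k} k<n = let j , n≡ = <⇒+suc k<n in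
  j , trans (k≡ k (+ suc j)) (cong (ℤ._- + suc j) (sym n≡))
  where
  k≡ : ∀ k j → k ≡ k ℤ.+ j ℤ.- j
  k≡ = solve-∀

nonnegative-ahead : ∀ n N {i} → N + ∣ n ∣ ≤ i → ∃[ j ] N ≤ j × n ℤ.+ + j ≡ + i
nonnegative-ahead (+ m) N {i} N+m≤i =
  i ∸ m , subst (_≤ i ∸ m) (m+n∸n≡m N m) (∸-monoˡ-≤ m N+m≤i) ,
  cong +_ (m+[n∸m]≡n (≤-trans (m≤n+m m N) N+m≤i))
nonnegative-ahead -[1+ m ] N {i} N+m≤i =
  suc m + i , ≤-trans (≤-trans (m≤m+n N _) N+m≤i) (m≤n+m i _) ,
  trans (ℤₚ.⊖-≥ (m≤m+n (suc m) i)) (cong +_ (m+n∸m≡n (suc m) i))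

-- Fairness is known along a half-line from 0 but needed from every `n`. The slack ∣ `n` ∣ ensures
-- that a far index is reached from `n` by at least `N` moves, on whichever side of 0 `n` lies.
arm-ahead : ∀ d n N {i} → N + ∣ n ∣ ≤ i → ∃[ j ] N ≤ j × move d n j ≡ signed d i
arm-ahead future = nonnegative-ahead
arm-ahead past n N {i} N+n≤i =
  let j , N≤j , eq = nonnegative-ahead (ℤ.- n) N (subst (λ m → N + m ≤ i) (sym (ℤₚ.∣-i∣≡∣i∣ n)) N+n≤i) in
  j , N≤j , trans (flip-sign n (+ j)) (cong ℤ.-_ eq)
  where
  flip-sign : ∀ n j → n ℤ.- j ≡ ℤ.- (ℤ.- n ℤ.+ j)
  flip-sign = solve-∀

Quantified : Bool → (ℕ → Set) → Set
Quantified true  P = ∀ j → P j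
Quantified false P = ∃[ j ] P j

Joined : Bool → Set → Set → Set
Joined true  P Q = P × Q
Joined false P Q = P ⊎ Q

joined : Bool → Bool → Bool → Bool
joined true  a b = a ∧ b
joined false a b = a ∨ b

quantified-unfold : ∀ q {P} → Quantified q P ⇔ Joined q (P 0) (Quantified q (P ∘ suc))
quantified-unfold true  = mk⇔ (λ h → h 0 , h ∘ suc) (λ { (p , h) zero → p ; (p , h) (suc j) → h j })
quantified-unfold false = mk⇔ (λ { (zero , p) → inj₁ p ; (suc j , p) → inj₂ (j , p) })
                              [ (λ p → 0 , p) , (λ (j , p) → suc j , p) ]′

quantified-cong : ∀ q {P Q} → (∀ j → P j ⇔ Q j) → Quantified q P → Quantified q Q
quantified-cong true  P⇔Q h       = λ j → to (P⇔Q j) (h j)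
quantified-cong false P⇔Q (j , p) = j , to (P⇔Q j) p

joined-cong : ∀ q {P P′ Q Q′} → (P → P′) → (Q → Q′) → Joined q P Q → Joined q P′ Q′
joined-cong true  f g = Product.map f g
joined-cong false f g = Sum.map f g

unbounded-sem : ∀ d q {P n} → ⟦ unbounded d q ⟧ᵒ P n ⇔ Quantified q (λ j → P (move d n (suc j)))
unbounded-sem future true {P} = mk⇔
  (λ h j → h _ (move-beyond future _ j))
  (λ h k n<k → let j , k≡ = beyond⇒move future n<k in subst P (sym k≡) (h j))
unbounded-sem past   true {P} = mk⇔
  (λ h j → h _ (move-beyond past _ j))
  (λ h k k<n → let j , k≡ = beyond⇒move past k<n in subst P (sym k≡) (h j))
unbounded-sem future false {P} = mk⇔
  (λ (k , n<k , p) → let j , k≡ = beyond⇒move future n<k in j , subst P k≡ p)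
  (λ (j , p) → _ , move-beyond future _ j , p)
unbounded-sem past   false {P} = mk⇔
  (λ (k , k<n , p) → let j , k≡ = beyond⇒move past k<n in j , subst P k≡ p)
  (λ (j , p) → _ , move-beyond past _ j , p)

unbounded-unfold : ∀ d q {P n} → ⟦ unbounded d q ⟧ᵒ P n ⇔
                   Joined q (P (move d n 1)) (⟦ unbounded d q ⟧ᵒ P (move d n 1))
unbounded-unfold d q {P} {n} = mk⇔
  (joined-cong q id (from (unbounded-sem d q) ∘ quantified-cong q (λ j → mk⇔ (retreat j) (advance j)))
    ∘ to (quantified-unfold q) ∘ to (unbounded-sem d q))
  (from (unbounded-sem d q) ∘ from (quantified-unfold q)
    ∘ joined-cong q id (quantified-cong q (λ j → mk⇔ (advance j) (retreat j)) ∘ to (unbounded-sem d q)))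
  where
  advance : ∀ j → P (move d (move d n 1) (suc j)) → P (move d n (suc (suc j)))
  advance j = subst P (move-+ d n 1 (suc j))
  retreat : ∀ j → P (move d n (suc (suc j))) → P (move d (move d n 1) (suc j))
  retreat j = subst P (sym (move-+ d n 1 (suc j)))

-- α is the value of a □ (q = true) or ◇ (q = false) formula, β that of its argument.
-- Fairness excludes that the value of α is postponed for ever.
unfolding⇒quantified : ∀ q (α β : ℕ → Bool) →
  (∀ j → α j ≡ joined q (β (suc j)) (α (suc j))) →
  (∀ n → ∃[ i ] n ≤ i × (α i ≡ q ⊎ β i ≡ not q)) →
  α 0 ≡ true ⇔ Quantified q (λ j → β (suc j) ≡ true)
unfolding⇒quantified true α β unfold fair = mk⇔ forth back
  where
  α-true : α 0 ≡ true → ∀ j → α j ≡ true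
  α-true α₀ zero    = α₀
  α-true α₀ (suc j) with β (suc j) | α (suc j) | trans (sym (unfold j)) (α-true α₀ j)
  ... | true | true | _ = refl
  forth : α 0 ≡ true → ∀ j → β (suc j) ≡ true
  forth α₀ j with β (suc j) | trans (sym (unfold j)) (α-true α₀ j)
  ... | true | _ = refl
  back : (∀ j → β (suc j) ≡ true) → α 0 ≡ true
  -- Fairness is asked from index 1 on, because `β 0` is not among the values quantified over.
  back βs = descend i (settle (fair 1))
    where
    i = proj₁ (fair 1)
    settle : (f : ∃[ i ] 1 ≤ i × (α i ≡ true ⊎ β i ≡ false)) → α (proj₁ f) ≡ true
    settle (i     , _ , inj₁ αᵢ) = αᵢ
    settle (suc i , _ , inj₂ βᵢ) = contradiction (trans (sym (βs i)) βᵢ) λ ()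
    descend : ∀ i → α i ≡ true → α 0 ≡ true
    descend zero    αᵢ = αᵢ
    descend (suc i) αᵢ = descend i (trans (unfold i) (cong₂ _∧_ (βs i) αᵢ))
unfolding⇒quantified false α β unfold fair = mk⇔ forth back
  where
  search : ∀ i → α 0 ≡ true → (∃[ j ] β (suc j) ≡ true) ⊎ α i ≡ true
  search zero    α₀ = inj₂ α₀
  search (suc i) α₀ with search i α₀
  ... | inj₁ found = inj₁ found
  ... | inj₂ αᵢ with β (suc i) in eq | trans (sym (unfold i)) αᵢ
  ...   | true  | _    = inj₁ (i , eq)
  ...   | false | αᵢ₊₁ = inj₂ αᵢ₊₁
  forth : α 0 ≡ true → ∃[ j ] β (suc j) ≡ true
  forth α₀ with fair 1
  ... | suc i , _ , inj₂ βᵢ = i , βᵢ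
  ... | i     , _ , inj₁ αᵢ with search i α₀
  ...   | inj₁ found = found
  ...   | inj₂ αᵢ′   = contradiction (trans (sym αᵢ′) αᵢ) λ ()
  descend : ∀ i → α i ≡ true → α 0 ≡ true
  descend zero    αᵢ = αᵢ
  descend (suc i) αᵢ = descend i (trans (unfold i) (trans (cong (β (suc i) ∨_) αᵢ) (∨-zeroʳ _)))
  back : (∃[ j ] β (suc j) ≡ true) → α 0 ≡ true
  back (j , βⱼ) = descend j (trans (unfold j) (cong (_∨ α (suc j)) βⱼ))

-- Models as fair two-way infinite paths.

module Models (em : ExcludedMiddle 0ℓ) (𝒪 : Ontology) (A : Atom) where
  open KromFormula
  open Classical em
  open States em 𝒪 A

  ⌊⌋-joined : ∀ q {P Q} → ⌊ Joined q P Q ⌋ ≡ joined q ⌊ P ⌋ ⌊ Q ⌋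
  ⌊⌋-joined true  {P} {Q} with em {P} | em {Q} | em {P × Q}
  ... | yes p | yes q | yes _  = refl
  ... | yes p | yes q | no ¬pq = contradiction (p , q) ¬pq
  ... | yes p | no ¬q | yes pq = contradiction (proj₂ pq) ¬q
  ... | yes p | no ¬q | no _   = refl
  ... | no ¬p | _     | yes pq = contradiction (proj₁ pq) ¬p
  ... | no ¬p | _     | no _   = refl
  ⌊⌋-joined false {P} {Q} with em {P} | em {Q} | em {P ⊎ Q}
  ... | yes p | _     | yes _  = refl
  ... | yes p | _     | no ¬pq = contradiction (inj₁ p) ¬pq
  ... | no ¬p | yes q | yes _  = refl
  ... | no ¬p | yes q | no ¬pq = contradiction (inj₂ q) ¬pq
  ... | no ¬p | no ¬q | yes pq = ⊥-elim ([ ¬p , ¬q ]′ pq)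
  ... | no ¬p | no ¬q | no _   = refl

  EdgeTo : Side → Rel State 0ℓ
  EdgeTo future s s′ = Edge s s′
  EdgeTo past   s s′ = Edge s′ s

  edge-unfold : ∀ d q {s s′ ops B} → EdgeTo d s s′ → (unbounded d q ∷ ops) ▸ B ∈ closure →
    val s ((unbounded d q ∷ ops) ▸ B) ≡ joined q (val s′ (ops ▸ B)) (val s′ ((unbounded d q ∷ ops) ▸ B))
  edge-unfold future true  e p∈ = e _ _ _ p∈
  edge-unfold future false e p∈ = e _ _ _ p∈
  edge-unfold past   true  e p∈ = e _ _ _ p∈
  edge-unfold past   false e p∈ = e _ _ _ p∈

  -- Phrased as a condition met infinitely often, so that it depends only on the
  -- tail of r and survives gluing; q = true stands for □ and q = false for ◇.
  Fair : Side → (ℕ → State) → Set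
  Fair d r = ∀ q ops B → (unbounded d q ∷ ops) ▸ B ∈ closure → ∀ n → ∃[ i ] n ≤ i ×
    (val (r i) ((unbounded d q ∷ ops) ▸ B) ≡ q ⊎ val (r i) (ops ▸ B) ≡ not q)

  record Trajectory (Λ : ℤ → State) : Set where
    field
      valid : ∀ n → Valid (Λ n)
      edge  : ∀ n → Edge (Λ n) (Λ (n ℤ.+ 1ℤ))
      fair  : ∀ d n → Fair d (λ j → Λ (move d n j))

  module _ {Λ : ℤ → State} (τ : Trajectory Λ) where
    open Trajectory τ

    edge-move : ∀ d n j → EdgeTo d (Λ (move d n j)) (Λ (move d n (suc j)))
    edge-move future n j = subst (λ k → Edge (Λ (n ℤ.+ + j)) (Λ k)) (next n (+ j)) (edge (n ℤ.+ + j))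
      where
      next : ∀ n j → n ℤ.+ j ℤ.+ 1ℤ ≡ n ℤ.+ (1ℤ ℤ.+ j)
      next = solve-∀
    edge-move past n j = subst (λ k → Edge (Λ (n ℤ.- + suc j)) (Λ k)) (previous n (+ j)) (edge (n ℤ.- + suc j))
      where
      previous : ∀ n j → n ℤ.- (1ℤ ℤ.+ j) ℤ.+ 1ℤ ≡ n ℤ.- j
      previous = solve-∀

    model : Interpretation
    model B n = val (Λ n) ([] ▸ B) ≡ true

    -- Induction on the prefix, whose tails stay in the closure: ○ is read off a single edge, □ and
    -- ◇ combine the unfolding along a half-line with fairness.
    truth : ∀ ops B → ops ▸ B ∈ closure → ∀ n → ⟦ ops ▸ B ⟧ᵖ model n ⇔ (val (Λ n) (ops ▸ B) ≡ true)

    truth-unbounded : ∀ d q ops B → (unbounded d q ∷ ops) ▸ B ∈ closure → ∀ n →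
      ⟦ unbounded d q ⟧ᵒ (⟦ ops ▸ B ⟧ᵖ model) n ⇔ (val (Λ n) ((unbounded d q ∷ ops) ▸ B) ≡ true)
    truth-unbounded d q ops B p∈ n = mk⇔
      (subst (λ k → val (Λ k) p ≡ true) (move-0 d n)
        ∘ from unfolded ∘ quantified-cong q (λ j → truth ops B (tail∈closure p∈) _) ∘ to (unbounded-sem d q))
      (from (unbounded-sem d q) ∘ quantified-cong q (λ j → mk⇔ (from (ih j)) (to (ih j))) ∘ to unfolded
        ∘ subst (λ k → val (Λ k) p ≡ true) (sym (move-0 d n)))
      where
      p = (unbounded d q ∷ ops) ▸ B
      ih : ∀ j → ⟦ ops ▸ B ⟧ᵖ model (move d n (suc j)) ⇔ (val (Λ (move d n (suc j))) (ops ▸ B) ≡ true)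
      ih j = truth ops B (tail∈closure p∈) _
      unfolded = unfolding⇒quantified q (λ j → val (Λ (move d n j)) p) (λ j → val (Λ (move d n j)) (ops ▸ B))
        (λ j → edge-unfold d q (edge-move d n j) p∈) (fair d n q ops B p∈)

    truth []         B p∈ n = mk⇔ id id
    truth (○F ∷ ops) B p∈ n = subst (λ b → ⟦ ops ▸ B ⟧ᵖ model (n ℤ.+ 1ℤ) ⇔ (b ≡ true)) (sym (edge n _ _ _ p∈))
      (truth ops B (tail∈closure p∈) (n ℤ.+ 1ℤ))
    truth (○P ∷ ops) B p∈ n = subst (λ b → ⟦ ops ▸ B ⟧ᵖ model (n ℤ.- 1ℤ) ⇔ (b ≡ true))
      (trans (sym (edge (n ℤ.- 1ℤ) _ _ _ p∈)) (cong (λ k → val (Λ k) ((○P ∷ ops) ▸ B)) (back n)))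
      (truth ops B (tail∈closure p∈) (n ℤ.- 1ℤ))
      where
      back : ∀ n → n ℤ.- 1ℤ ℤ.+ 1ℤ ≡ n
      back = solve-∀
    truth (□F ∷ ops) B p∈ n = truth-unbounded future true  ops B p∈ n
    truth (□P ∷ ops) B p∈ n = truth-unbounded past   true  ops B p∈ n
    truth (◇F ∷ ops) B p∈ n = truth-unbounded future false ops B p∈ n
    truth (◇P ∷ ops) B p∈ n = truth-unbounded past   false ops B p∈ n

    model⊨ᴼ : model ⊨ᴼ 𝒪
    model⊨ᴼ α α∈ n = from (boolComb-cong (shape α) (λ i → truth _ _ (part∈closure α∈ i) n)) (valid n α α∈)

  module Description (𝔐 : Interpretation) (𝔐⊨𝒪 : 𝔐 ⊨ᴼ 𝒪) where

    Λ : ℤ → State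
    Λ n = state (λ p → ⌊ ⟦ p ⟧ᵖ 𝔐 n ⌋)

    val-Λ : ∀ {p} n → p ∈ closure → val (Λ n) p ≡ ⌊ ⟦ p ⟧ᵖ 𝔐 n ⌋
    val-Λ n p∈ = val-state _ p∈

    val-unbounded : ∀ d q {ops B} n → (unbounded d q ∷ ops) ▸ B ∈ closure →
      val (Λ n) ((unbounded d q ∷ ops) ▸ B) ≡
      joined q (val (Λ (move d n 1)) (ops ▸ B)) (val (Λ (move d n 1)) ((unbounded d q ∷ ops) ▸ B))
    val-unbounded d q {ops} {B} n p∈ = begin
      val (Λ n) p                                       ≡⟨ val-Λ n p∈ ⟩
      ⌊ ⟦ p ⟧ᵖ 𝔐 n ⌋                                    ≡⟨ ⌊⌋-cong (unbounded-unfold d q) ⟩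
      ⌊ Joined q (⟦ ops ▸ B ⟧ᵖ 𝔐 n′) (⟦ p ⟧ᵖ 𝔐 n′) ⌋    ≡⟨ ⌊⌋-joined q ⟩
      joined q ⌊ ⟦ ops ▸ B ⟧ᵖ 𝔐 n′ ⌋ ⌊ ⟦ p ⟧ᵖ 𝔐 n′ ⌋    ≡⟨ cong₂ (joined q) (val-Λ n′ (tail∈closure p∈))
                                                                           (val-Λ n′ p∈) ⟨
      joined q (val (Λ n′) (ops ▸ B)) (val (Λ n′) p)    ∎
      where
      open ≡-Reasoning
      p = (unbounded d q ∷ ops) ▸ B
      n′ = move d n 1

    val-past : ∀ q {ops B} n → (unbounded past q ∷ ops) ▸ B ∈ closure →
      val (Λ (n ℤ.+ 1ℤ)) ((unbounded past q ∷ ops) ▸ B) ≡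
      joined q (val (Λ n) (ops ▸ B)) (val (Λ n) ((unbounded past q ∷ ops) ▸ B))
    val-past q {ops} {B} n p∈ = trans (val-unbounded past q (n ℤ.+ 1ℤ) p∈)
      (cong (λ k → joined q (val (Λ k) (ops ▸ B)) (val (Λ k) ((unbounded past q ∷ ops) ▸ B))) (back n))
      where
      back : ∀ n → n ℤ.+ 1ℤ ℤ.- 1ℤ ≡ n
      back = solve-∀

    edge : ∀ n → Edge (Λ n) (Λ (n ℤ.+ 1ℤ))
    edge n ○F ops B p∈ = trans (val-Λ n p∈) (sym (val-Λ (n ℤ.+ 1ℤ) (tail∈closure p∈)))
    edge n ○P ops B p∈ = trans (val-Λ (n ℤ.+ 1ℤ) p∈)
      (trans (cong (λ k → ⌊ ⟦ ops ▸ B ⟧ᵖ 𝔐 k ⌋) (back n)) (sym (val-Λ n (tail∈closure p∈))))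
      where
      back : ∀ n → n ℤ.+ 1ℤ ℤ.- 1ℤ ≡ n
      back = solve-∀
    edge n □F ops B p∈ = val-unbounded future true n p∈
    edge n ◇F ops B p∈ = val-unbounded future false n p∈
    edge n □P ops B p∈ = val-past true n p∈
    edge n ◇P ops B p∈ = val-past false n p∈

    -- Either the formula already has the value `q` at `N`, or a strictly later witness for ◇,
    -- respectively counterexample to □, gives its argument the opposite value.
    fair : ∀ d n → Fair d (λ j → Λ (move d n j))
    fair d n q ops B p∈ N = settle q p∈ (em {⟦ unbounded d q ⟧ᵒ P k})
      where
      P = ⟦ ops ▸ B ⟧ᵖ 𝔐
      k = move d n N
      Settled : Bool → Set
      Settled q = ∃[ i ] N ≤ i × (val (Λ (move d n i)) ((unbounded d q ∷ ops) ▸ B) ≡ q ⊎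
                                  val (Λ (move d n i)) (ops ▸ B) ≡ not q)
      later : ∀ j {b} → ⌊ P (move d k (suc j)) ⌋ ≡ b → ops ▸ B ∈ closure →
              val (Λ (move d n (N + suc j))) (ops ▸ B) ≡ b
      later j eq p∈ = trans (cong (λ k → val (Λ k) (ops ▸ B)) (sym (move-+ d n N (suc j))))
                            (trans (val-Λ _ p∈) eq)
      settle : ∀ q → (unbounded d q ∷ ops) ▸ B ∈ closure → Dec (⟦ unbounded d q ⟧ᵒ P k) → Settled q
      settle true  p∈ (yes h) = N , ≤-refl , inj₁ (trans (val-Λ k p∈) (⌊⌋-true h))
      settle false p∈ (no ¬h) = N , ≤-refl , inj₁ (trans (val-Λ k p∈) (⌊⌋-no ¬h))
      settle false p∈ (yes h) = let j , Pj = to (unbounded-sem d false) h in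
        N + suc j , m≤m+n N (suc j) , inj₂ (later j (⌊⌋-true Pj) (tail∈closure p∈))
      settle true  p∈ (no ¬h) with em {∃[ j ] ¬ P (move d k (suc j))}
      ... | yes (j , ¬Pj) = N + suc j , m≤m+n N (suc j) , inj₂ (later j (⌊⌋-no ¬Pj) (tail∈closure p∈))
      ... | no ¬∃ = contradiction
        (from (unbounded-sem d true) λ j → Dec.decidable-stable em (λ ¬Pj → ¬∃ (j , ¬Pj))) ¬h

    trajectory : Trajectory Λ
    trajectory = record
      { valid = λ n α α∈ → to (boolComb-cong (shape α) λ i → let eq = val-Λ n (part∈closure α∈ i) in
          mk⇔ (λ h → trans eq (⌊⌋-true h)) (λ h → ⌊⌋-sound (trans (sym eq) h))) (𝔐⊨𝒪 α α∈ n)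
      ; edge  = edge
      ; fair  = fair
      }

  HalfRun : Side → State → Set
  HalfRun d s = ∃[ r ] r 0 ≡ s × (∀ i → Valid (r i)) × (∀ i → EdgeTo d (r i) (r (suc i))) × Fair d r

  halfRun : ∀ {Λ} → Trajectory Λ → ∀ d n → HalfRun d (Λ n)
  halfRun {Λ} τ d n = (λ j → Λ (move d n j)) , cong Λ (move-0 d n) , (λ j → valid (move d n j)) ,
    edge-move τ d n , fair d n
    where open Trajectory τ

  fair-shift : ∀ d {f g : ℕ → State} m → (∀ i → f (i + m) ≡ g i) → Fair d g → Fair d f
  fair-shift d {f} {g} m f~g G q ops B p∈ n =
    let i , n≤i , settled = G q ops B p∈ n in
    i + m , ≤-trans n≤i (m≤m+n i m) ,
    subst (λ s → val s ((unbounded d q ∷ ops) ▸ B) ≡ q ⊎ val s (ops ▸ B) ≡ not q) (sym (f~g i)) settled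

  module Assembly (l r : ℕ → State) (l₀≡r₀ : l 0 ≡ r 0)
    (l-valid : ∀ i → Valid (l i)) (l-edge : ∀ i → Edge (l (suc i)) (l i)) (l-fair : Fair past l)
    (r-run : ∀ n → Run (λ _ → Valid) 0 n r) (r-fair : Fair future r) where

    Λ : ℤ → State
    Λ (+ i)    = r i
    Λ -[1+ i ] = l (suc i)

    arm : Side → ℕ → State
    arm future = r
    arm past   = l

    Λ-arm : ∀ d i → Λ (signed d i) ≡ arm d i
    Λ-arm future i       = refl
    Λ-arm past   zero    = sym l₀≡r₀
    Λ-arm past   (suc i) = refl

    arm-fair : ∀ d → Fair d (arm d)
    arm-fair future = r-fair
    arm-fair past   = l-fair

    trajectory : Trajectory Λ
    trajectory = record { valid = valid ; edge = edge ; fair = fair }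
      where
      valid : ∀ n → Valid (Λ n)
      valid (+ i)    = holds (r-run i) i z≤n ≤-refl
      valid -[1+ i ] = l-valid (suc i)
      edge : ∀ n → Edge (Λ n) (Λ (n ℤ.+ 1ℤ))
      edge (+ i)        = subst (λ j → Edge (r i) (r j)) (+-comm 1 i) (steps (r-run (suc i)) i z≤n ≤-refl)
      edge -[1+ zero ]  = subst (Edge (l 1)) l₀≡r₀ (l-edge 0)
      edge -[1+ suc i ] = l-edge (suc i)
      fair : ∀ d n → Fair d (λ j → Λ (move d n j))
      fair d n q ops B p∈ N with i , N+n≤i , settled ← arm-fair d q ops B p∈ (N + ∣ n ∣)
                            with j , N≤j , eq ← arm-ahead d n N N+n≤i =
        j , N≤j , subst (λ s → val s ((unbounded d q ∷ ops) ▸ B) ≡ q ⊎ val s (ops ▸ B) ≡ not q)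
                    (sym (trans (cong Λ eq) (Λ-arm d i))) settled

  module Counterexamples (𝒜 : DataInstance) where
    open Domain 𝒜
    open DataInstance 𝒜 using (min-least; max-great)
    open Fitting Data

    -- The run is cut at `i` since a passage names its end states only; the cut exposes the state in
    -- which `A` is refuted.
    Counterexample : ℕ → Set
    Counterexample i = ∃₂ λ s t → (HalfRun past s × HalfRun future t) × ∃[ u ] (val u ([] ▸ A) ≡ false) ×
      Passage 0 s i u × Passage i u last t

    model⇒counterexample : ∀ {𝔐 i} → 𝔐 ⊨ᴼ 𝒪 → 𝔐 ⊨ᴬ 𝒜 → i ≤ last → ¬ 𝔐 A (+ i) → Counterexample i
    model⇒counterexample {𝔐} {i} 𝔐⊨𝒪 𝔐⊨𝒜 i≤last ¬Ai =
      Λ 0ℤ , Λ (+ last) , (halfRun trajectory past 0ℤ , halfRun trajectory future (+ last)) ,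
      Λ (+ i) , trans (val-Λ (+ i) query∈closure) (⌊⌋-no ¬Ai) ,
      (z≤n , Λ ∘ +_ , refl , refl , run) , (i≤last , Λ ∘ +_ , refl , refl , run)
      where
      open Description 𝔐 𝔐⊨𝒪
      fits : ∀ j → Fits j (Λ (+ j))
      fits j B d = [ (λ B∈ → trans (val-Λ (+ j) B∈) (⌊⌋-true (𝔐⊨𝒜 B (+ j) d))) , val-∉ (Λ (+ j)) ]′
        (Dec.toSum em)
      run : ∀ {x y} → Run (λ j u → Valid u × Fits j u) x y (Λ ∘ +_)
      run = record
        { holds = λ j _ _ → Trajectory.valid trajectory (+ j) , fits j
        ; steps = λ j _ _ → subst (λ k → Edge (Λ (+ j)) (Λ (+ k))) (+-comm j 1) (edge (+ j))
        }

    -- The past half-run, the two passages and the future half-run are glued at 0, `i` and `last`.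
    -- Fairness survives because it concerns tails only.
    counterexample⇒model : ∀ {i} → Counterexample i → ∃[ 𝔐 ] 𝔐 ⊨ᴼ 𝒪 × 𝔐 ⊨ᴬ 𝒜 × ¬ 𝔐 A (+ i)
    counterexample⇒model {i}
      (s , t , ((l , l₀ , l-valid , l-edge , l-fair) , (g , g₀ , g-valid , g-edge , g-fair)) ,
       u , ¬A , (0≤i , f , f₀ , fᵢ , F) , (i≤last , h , hᵢ , h-last , H)) =
      model trajectory , model⊨ᴼ trajectory , fits-data , λ Ai → contradiction (trans (sym Ai) r-refutes) λ ()
      where
      fᵢ≡hᵢ : f i ≡ h i
      fᵢ≡hᵢ = trans fᵢ (sym hᵢ)
      c : ℕ → State
      c = splice i f h
      c-run : Run (λ j u → Valid u × Fits j u) 0 last c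
      c-run = splice-run fᵢ≡hᵢ F H
      g′ : ℕ → State
      g′ j = g (j ∸ last)
      c≡g′ : c last ≡ g′ last
      c≡g′ = trans (splice-≥ fᵢ≡hᵢ i≤last) (trans h-last (trans (sym g₀) (cong g (sym (n∸n≡0 last)))))
      r : ℕ → State
      r = splice last c g′
      r₀ : r 0 ≡ s
      r₀ = trans (splice-≤ z≤n) (trans (splice-≤ z≤n) f₀)
      rᵢ : r i ≡ u
      rᵢ = trans (splice-≤ i≤last) (trans (splice-≤ ≤-refl) fᵢ)
      r-refutes : val (r i) ([] ▸ A) ≡ false
      r-refutes = trans (cong (λ s → val s ([] ▸ A)) rᵢ) ¬A
      r-run : ∀ n → Run (λ _ → Valid) 0 n r
      r-run n = splice-run c≡g′ (map-run (λ _ _ _ → proj₁) c-run) record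
        { holds = λ j _ _ → g-valid (j ∸ last)
        ; steps = λ j last≤j _ → subst (λ k → Edge (g′ j) (g k)) (sym (+-∸-assoc 1 last≤j)) (g-edge (j ∸ last))
        }
      r-fair : Fair future r
      r-fair = fair-shift future last
        (λ j → trans (splice-≥ c≡g′ (m≤n+m last j)) (cong g (m+n∸n≡m j last))) g-fair
      open Assembly l r (trans l₀ (sym r₀)) l-valid l-edge l-fair r-run r-fair
      fits-data : model trajectory ⊨ᴬ 𝒜
      fits-data B n d = subst (λ k → val (Λ k) ([] ▸ B) ≡ true) (+pos e)
        (trans (cong (λ s → val s ([] ▸ B)) (splice-≤ (pos≤last e)))
               (proj₂ (holds c-run (pos e) z≤n (pos≤last e)) B (to (data-pos e B) d)))
        where
        e : Dom
        e = n , min-least n (B , d) , max-great n (B , d)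

-- The rewriting.

module Rewriting (em : ExcludedMiddle 0ℓ) (𝒪 : Ontology) (A : Atom) where
  open Classical em
  open States em 𝒪 A
  open Formulas em 𝒪 A
  open Models em 𝒪 A

  throughᶠ : ∀ {n} → State → State → Fin n → Fin n → Fin n → State → FO n
  throughᶠ s t x y ℓ u = guardᶠ (val u ([] ▸ A) ≡ false) ∧ᶠ (passageᶠ s u x ℓ ∧ᶠ passageᶠ u t ℓ y)

  betweenᶠ : ∀ {n} → Fin n → Fin n → Fin n → State → State → FO n
  betweenᶠ x y ℓ s t = guardᶠ (HalfRun past s × HalfRun future t) ∧ᶠ ⋁ₛ (throughᶠ s t x y ℓ)

  -- The language has no constants, so both ends of the active domain are quantified and pinned down
  -- as its least and greatest elements.
  counterexampleᶠ : FO 1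
  counterexampleᶠ = ∃ᶠ ∃ᶠ (firstᶠ (suc zero) ∧ᶠ (lastᶠ zero ∧ᶠ
    ⋁ₛ (λ s → ⋁ₛ (betweenᶠ (suc zero) zero (suc (suc zero)) s))))

  module _ (𝒜 : DataInstance) where
    open Domain 𝒜
    open Meaning 𝒜
    open ClassicalMeaning 𝒜
    open FormulaMeaning 𝒜
    open Fitting Data
    open Counterexamples 𝒜

    ⊩-through : ∀ {n} (v : Vec Dom n) s t x y ℓ → (v ⊩ ⋁ₛ (throughᶠ s t x y ℓ)) ⇔
      (∃[ u ] (val u ([] ▸ A) ≡ false) × Passage (pos (lookup v x)) s (pos (lookup v ℓ)) u ×
        Passage (pos (lookup v ℓ)) u (pos (lookup v y)) t)
    ⊩-through v s t x y ℓ = mk⇔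
      (Product.map₂ (Product.map (to (⊩-guard v)) (Product.map (to (⊩-passage v s _ x ℓ)) (to (⊩-passage v _ t ℓ y))))
        ∘ to ⊩-⋁ₜ)
      (from ⊩-⋁ₜ ∘ Product.map₂
        (Product.map (from (⊩-guard v)) (Product.map (from (⊩-passage v s _ x ℓ)) (from (⊩-passage v _ t ℓ y)))))
      where ⊩-⋁ₜ = ⊩-⋁ v (2 ^ size) (throughᶠ s t x y ℓ)

    ⊩-counterexample : ∀ d → (d ∷ [] ⊩ counterexampleᶠ) ⇔ Counterexample (pos d)
    ⊩-counterexample d = mk⇔ forth (λ c → back c (element z≤n) (element ≤-refl))
      where
      forth : d ∷ [] ⊩ counterexampleᶠ → Counterexample (pos d)
      forth (x , y , first , final , h) =
        subst₂ (λ i j → ∃₂ λ s t → (HalfRun past s × HalfRun future t) × ∃[ u ] (val u ([] ▸ A) ≡ false) ×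
                  Passage i s (pos d) u × Passage (pos d) u j t)
          (to (⊩-first v (suc zero)) first) (to (⊩-last v zero) final)
          (Product.map₂ (λ {s} → Product.map₂ (λ {t} →
            Product.map (to (⊩-guard v)) (to (⊩-through v s t (suc zero) zero (suc (suc zero))))))
            (to (⊩-⋁⋁ v (betweenᶠ (suc zero) zero (suc (suc zero)))) h))
        where v = y ∷ x ∷ d ∷ []
      back : Counterexample (pos d) → ∃[ x ] pos x ≡ 0 → ∃[ y ] pos y ≡ last → d ∷ [] ⊩ counterexampleᶠ
      back (s , t , ends , u , ¬A , p , q) (x , x≡0) (y , y≡last) =
        x , y , from (⊩-first v (suc zero)) x≡0 , from (⊩-last v zero) y≡last ,
        from (⊩-⋁⋁ v (betweenᶠ (suc zero) zero (suc (suc zero)))) (s , t , from (⊩-guard v) ends ,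
          from (⊩-through v s t (suc zero) zero (suc (suc zero)))
            (u , ¬A , subst (λ i → Passage i s (pos d) u) (sym x≡0) p ,
                      subst (λ j → Passage (pos d) u j t) (sym y≡last) q))
        where v = y ∷ x ∷ d ∷ []

  rewriting : FO 1
  rewriting = ¬ᶠ counterexampleᶠ

  rewrites : rewriting Rewrites⟨ 𝒪 , A ⟩
  rewrites 𝒜 = ans⊆answers , answers⊆ans
    where
    open Domain 𝒜
    open Counterexamples 𝒜
    ans⊆answers : ∀ {n} → ans 𝒪 A 𝒜 n → answers rewriting 𝒜 n
    ans⊆answers {n} (n∈tem , certain) = n∈tem , λ h →
      let 𝔐 , 𝔐⊨𝒪 , 𝔐⊨𝒜 , ¬An = counterexample⇒model (to (⊩-counterexample 𝒜 d) h) in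
      ¬An (subst (𝔐 A) (sym (+pos d)) (certain 𝔐 𝔐⊨𝒪 𝔐⊨𝒜))
      where
      d : Dom
      d = n , n∈tem
    answers⊆ans : ∀ {n} → answers rewriting 𝒜 n → ans 𝒪 A 𝒜 n
    answers⊆ans {n} (n∈tem , ¬counterexample) = n∈tem , λ 𝔐 𝔐⊨𝒪 𝔐⊨𝒜 →
      Dec.decidable-stable em λ ¬An → ¬counterexample (from (⊩-counterexample 𝒜 d)
        (model⇒counterexample 𝔐⊨𝒪 𝔐⊨𝒜 (pos≤last d) (¬An ∘ subst (𝔐 A) (+pos d))))
      where
      d : Dom
      d = n , n∈tem

theoremB : ExcludedMiddle 0ℓ → (𝒪 : Ontology) (A : Atom) → ∃[ Q ] Q Rewrites⟨ 𝒪 , A ⟩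
theoremB em 𝒪 A = rewriting , rewrites
  where open Rewriting em 𝒪 A
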